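{- For $\gamma\in\mathbb Z$ put $$S_\gamma(q):=\sum_{\substack{\alpha,\beta\in\mathbb Z\\ \alpha+2\beta=\gamma}}(-1)^\beta\sum_{k_1=|\alpha|}^\infty\binom{2k_1}{k_1+\alpha}A_{k_1}(q)\sum_{k_2=|\beta|}^\infty\binom{2k_2}{k_2+\beta}A_{k_2}(q).$$ Then for every integer $n$, $$\frac{1}{R_{1,4}(q)F_5(q)}=q^{ -\frac{5n^2-n}{2}}\big\{S_{5n+1}(q)+S_{5n}(q)-S_{5n-1}(q)-S_{5n-2}(q)\big\}$$ and $$\frac{1}{R_{2,3}(q)F_5(q)}=q^{ -\frac{5n^2-3n}{2}}\big\{S_{5n}(q)+S_{5n-1}(q)-S_{5n-2}(q)-S_{5n-3}(q)\big\}.$$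
   Context: Here $(a;q)_\infty:=\prod_{j=0}^\infty(1-aq^j)$ for $|q|<1$. Identities may be read as identities of formal Laurent series in $q$ (equivalently, for $0<|q|<1$). For integers $k\ge0$, $$A_k(q):=\sum_{0<t_1<t_2<\cdots<t_k}\frac{q^{t_1+\cdots+t_k}}{(1-q^{t_1})^2\cdots(1-q^{t_k})^2},\qquad A_0(q)=1.$$ The Rogers–Ramanujan functions and $F_5$ are $$R_{1,4}(q):=\prod_{n=0}^\infty\frac{1}{(1-q^{5n+1})(1-q^{5n+4})},\qquad R_{2,3}(q):=\prod_{n=0}^\infty\frac{1}{(1-q^{5n+2})(1-q^{5n+3})},\qquad F_5(q):=\frac{(q;q)_\infty^6}{(q^5;q^5)_\infty}.$$ -}

module Defs where

open import Data.Nat.Base as ℕ using (ℕ; zero; suc; _∸_; _<_; _≤_; z≤n; s≤s)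
import Data.Nat.Properties as ℕ
open import Data.Nat.Combinatorics using (_C_)
open import Data.Integer.Base as ℤ using (ℤ; +_; -[1+_]; 0ℤ; 1ℤ; -1ℤ; ∣_∣)
import Data.Integer.Properties as ℤ
open import Data.Fin.Base as Fin using (Fin; toℕ)
import Data.Fin.Properties as Fin
open import Data.Vec.Base using (Vec; []; _∷_; map; sum)
open import Data.Sum.Base using (inj₁; inj₂)
open import Function.Base using (_∘_)
open import Relation.Binary.PropositionalEquality
open import Algebra.Properties.Monoid.Sum ℤ.+-0-monoid
  using (sum-syntax; sum⁺-syntax; sum-cong-≗; sum-replicate-zero)

-- Formal power series in q over ℤ: f n is the coefficient of q^n.
PowerSeries : Set
PowerSeries = ℕ → ℤ

infix  9 q^_
infixr 8 _^ˢ_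
infixl 7 _*ˢ_
infixr 7 _•_
infixl 6 _+ˢ_ _-ˢ_

0ˢ : PowerSeries
0ˢ _ = 0ℤ

q^_ : ℕ → PowerSeries
(q^ zero)  zero    = 1ℤ
(q^ zero)  (suc n) = 0ℤ
(q^ suc m) zero    = 0ℤ
(q^ suc m) (suc n) = (q^ m) n

1ˢ : PowerSeries
1ˢ = q^ 0

_+ˢ_ _-ˢ_ _*ˢ_ : PowerSeries → PowerSeries → PowerSeries
(f +ˢ g) n = f n ℤ.+ g n
(f -ˢ g) n = f n ℤ.- g n
(f *ˢ g) n = ∑[ i ≤ n ] (f (toℕ i) ℤ.* g (n ∸ toℕ i))

_•_ : ℤ → PowerSeries → PowerSeries
(c • f) n = c ℤ.* f n

_^ˢ_ : PowerSeries → ℕ → PowerSeries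
f ^ˢ zero  = 1ˢ
f ^ˢ suc k = f *ˢ f ^ˢ k

infix 4 _≡_[mod-q^_]

_≡_[mod-q^_] : PowerSeries → PowerSeries → ℕ → Set
f ≡ g [mod-q^ k ] = ∀ n → n < k → f n ≡ g n

O[q^_] : ℕ → PowerSeries → Set
O[q^ k ] f = f ≡ 0ˢ [mod-q^ k ]

∑-zero : ∀ {n} {f : Fin n → ℤ} → (∀ i → f i ≡ 0ℤ) → ∑[ i < n ] f i ≡ 0ℤ
∑-zero {n} f≡0 = trans (sum-cong-≗ f≡0) (sum-replicate-zero n)

O-≤ : ∀ {j k f} → j ≤ k → O[q^ k ] f → O[q^ j ] f
O-≤ j≤k hf n n<j = hf n (ℕ.<-≤-trans n<j j≤k)

O-q^ : ∀ m → O[q^ m ] (q^ m)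
O-q^ (suc m) zero    _         = refl
O-q^ (suc m) (suc n) (s≤s n<m) = O-q^ m n n<m

O-• : ∀ {k f} c → O[q^ k ] f → O[q^ k ] (c • f)
O-• c hf n n<k = trans (cong (c ℤ.*_) (hf n n<k)) (ℤ.*-zeroʳ c)

O-* : ∀ {j k f g} → O[q^ j ] f → O[q^ k ] g → O[q^ j ℕ.+ k ] (f *ˢ g)
O-* {j} {k} {f} {g} hf hg n n<j+k = ∑-zero term
  where
  term : ∀ (i : Fin (suc n)) → f (toℕ i) ℤ.* g (n ∸ toℕ i) ≡ 0ℤ
  term i with ℕ.<-≤-connex (toℕ i) j
  ... | inj₁ i<j = cong (ℤ._* g (n ∸ toℕ i)) (hf (toℕ i) i<j)
  ... | inj₂ j≤i = trans (cong (f (toℕ i) ℤ.*_) (hg (n ∸ toℕ i) n∸i<k))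
                         (ℤ.*-zeroʳ (f (toℕ i)))
    where
    i≤n : toℕ i ≤ n
    i≤n = ℕ.≤-pred (Fin.toℕ<n i)
    n∸i<k : n ∸ toℕ i < k
    n∸i<k = ℕ.+-cancelˡ-< (toℕ i) _ _
      (subst (_< toℕ i ℕ.+ k) (sym (ℕ.m+[n∸m]≡n i≤n))
        (ℕ.<-≤-trans n<j+k (ℕ.+-monoˡ-≤ k j≤i)))

O-*ˡ : ∀ {k f} g → O[q^ k ] f → O[q^ k ] (f *ˢ g)
O-*ˡ {k} {f} g hf =
  subst (λ m → O[q^ m ] (f *ˢ g)) (ℕ.+-identityʳ k) (O-* {g = g} hf (λ _ ()))

O-*ʳ : ∀ {k g} f → O[q^ k ] g → O[q^ k ] (f *ˢ g)
O-*ʳ f hg = O-* {f = f} (λ _ ()) hg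

O-^ : ∀ {f} → O[q^ 1 ] f → ∀ k → O[q^ k ] (f ^ˢ k)
O-^ hf zero    = λ _ ()
O-^ {f} hf (suc k) = O-* {f = f} hf (O-^ hf k)

O⇒1-f≡1 : ∀ {k f} → O[q^ k ] f → 1ˢ -ˢ f ≡ 1ˢ [mod-q^ k ]
O⇒1-f≡1 hf n n<k =
  trans (cong (λ c → 1ˢ n ℤ.- c) (hf n n<k)) (ℤ.+-identityʳ (1ˢ n))

f≡1⇒O : ∀ {k f} → f ≡ 1ˢ [mod-q^ k ] → O[q^ k ] (1ˢ -ˢ f)
f≡1⇒O hf n n<k =
  trans (cong (λ c → 1ˢ n ℤ.- c) (hf n n<k)) (ℤ.+-inverseʳ (1ˢ n))

*≡1 : ∀ {k f g} → f ≡ 1ˢ [mod-q^ k ] → g ≡ 1ˢ [mod-q^ k ] →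
      f *ˢ g ≡ 1ˢ [mod-q^ k ]
*≡1 {k} {f} {g} hf hg n n<k = begin
  f 0 ℤ.* g n ℤ.+ ∑[ i < n ] (f (suc (toℕ i)) ℤ.* g (n ∸ suc (toℕ i)))
    ≡⟨ cong₂ ℤ._+_ (cong (ℤ._* g n) (hf 0 (ℕ.≤-<-trans z≤n n<k))) (∑-zero term) ⟩
  1ℤ ℤ.* g n ℤ.+ 0ℤ
    ≡⟨ trans (ℤ.+-identityʳ _) (ℤ.*-identityˡ (g n)) ⟩
  g n
    ≡⟨ hg n n<k ⟩
  1ˢ n ∎
  where
  open ≡-Reasoning
  term : ∀ (i : Fin n) → f (suc (toℕ i)) ℤ.* g (n ∸ suc (toℕ i)) ≡ 0ℤ
  term i = cong (ℤ._* g (n ∸ suc (toℕ i)))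
                (hf (suc (toℕ i)) (ℕ.≤-<-trans (Fin.toℕ<n i) n<k))

-- Infinite sums and products.  The hypothesis on the terms guarantees
-- q-adic convergence, and that the terms of index greater than n do not
-- contribute to the coefficient of q^n.
∑^∞ : (f : ℕ → PowerSeries) → .(∀ k → O[q^ k ] (f k)) → PowerSeries
∑^∞ f _ n = ∑[ k ≤ n ] f (toℕ k) n

∑^∞-from : (m : ℕ) (f : ℕ → PowerSeries) → .(∀ k → O[q^ k ] (f k)) → PowerSeries
∑^∞-from m f hf = ∑^∞ (λ j → f (m ℕ.+ j)) (λ j → O-≤ (ℕ.m≤n+m j m) (hf (m ℕ.+ j)))

∑^ℤ : (f : ℤ → PowerSeries) → .(∀ β → O[q^ ∣ β ∣ ] (f β)) → PowerSeries
∑^ℤ f hf = ∑^∞ (f ∘ +_) (hf ∘ +_)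
        +ˢ ∑^∞ (f ∘ -[1+_]) (λ k → O-≤ (ℕ.n≤1+n k) (hf -[1+ k ]))

∏^< : ℕ → (ℕ → PowerSeries) → PowerSeries
∏^< zero    f = 1ˢ
∏^< (suc n) f = ∏^< n f *ˢ f n

∏^∞ : (f : ℕ → PowerSeries) → .(∀ k → f k ≡ 1ˢ [mod-q^ k ]) → PowerSeries
∏^∞ f _ n = ∏^< (suc n) f n

O-∑^∞-from : ∀ {m f} (hf : ∀ k → O[q^ k ] (f k)) → O[q^ m ] (∑^∞-from m f hf)
O-∑^∞-from {m} hf n n<m =
  ∑-zero {suc n} (λ i → hf (m ℕ.+ toℕ i) n (ℕ.<-≤-trans n<m (ℕ.m≤m+n m (toℕ i))))

-- The reciprocal of a series f with constant term 1, as the geometric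
-- series of 1 - f.
O-1-f : ∀ {f} → f 0 ≡ 1ℤ → O[q^ 1 ] (1ˢ -ˢ f)
O-1-f f0≡1 = f≡1⇒O λ where zero _ → f0≡1
                           (suc _) (s≤s ())

recip : (f : PowerSeries) → .(f 0 ≡ 1ℤ) → PowerSeries
recip f f0≡1 = ∑^∞ ((1ˢ -ˢ f) ^ˢ_) (O-^ (O-1-f f0≡1))

recip≡1 : ∀ {k f} (f0≡1 : f 0 ≡ 1ℤ) → f ≡ 1ˢ [mod-q^ k ] →
          recip f f0≡1 ≡ 1ˢ [mod-q^ k ]
recip≡1 {f = f} f0≡1 hf n n<k =
  trans (cong (λ c → 1ˢ n ℤ.+ c)
                  (∑-zero (λ (i : Fin n) →
            O-*ˡ ((1ˢ -ˢ f) ^ˢ toℕ i) (f≡1⇒O hf) n n<k)))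
        (ℤ.+-identityʳ (1ˢ n))

-- (a ; p)_∞ for a series a and a base p without constant term
qPochhammer : (a p : PowerSeries) → .(O[q^ 1 ] p) → PowerSeries
qPochhammer a p hp =
  ∏^∞ (λ j → 1ˢ -ˢ a *ˢ p ^ˢ j) (λ j → O⇒1-f≡1 (O-*ʳ a (O-^ hp j)))

-- R-factor takes the predecessors of the two residues, so that the
-- constant terms compute to 1.
R-factor : (a b n : ℕ) → PowerSeries
R-factor a b n = recip ((1ˢ -ˢ q^ (suc a ℕ.+ 5 ℕ.* n)) *ˢ (1ˢ -ˢ q^ (suc b ℕ.+ 5 ℕ.* n))) refl

R-factor≡1 : ∀ a b n → R-factor a b n ≡ 1ˢ [mod-q^ n ]
R-factor≡1 a b n = recip≡1 refl (*≡1 (1-q^≡1 a) (1-q^≡1 b))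
  where
  1-q^≡1 : ∀ c → 1ˢ -ˢ q^ (suc c ℕ.+ 5 ℕ.* n) ≡ 1ˢ [mod-q^ n ]
  1-q^≡1 c = O⇒1-f≡1 (O-≤ (ℕ.≤-trans (ℕ.m≤n*m n 5) (ℕ.m≤n+m (5 ℕ.* n) (suc c)))
                          (O-q^ (suc c ℕ.+ 5 ℕ.* n)))

R₁₄ R₂₃ : PowerSeries
R₁₄ = ∏^∞ (R-factor 0 3) (R-factor≡1 0 3)
R₂₃ = ∏^∞ (R-factor 1 2) (R-factor≡1 1 2)

F₅ : PowerSeries
F₅ = qPochhammer (q^ 1) (q^ 1) (O-q^ 1) ^ˢ 6
  *ˢ recip (qPochhammer (q^ 5) (q^ 5) (O-≤ (s≤s z≤n) (O-q^ 5))) refl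

-- Sums over strictly increasing tuples.  ∑-increasing k s F is the sum of
-- F (u₁ , … , u_k) over all s ≤ u₁ < u₂ < ⋯ < u_k.  The tuple meant is
-- tᵢ = 1 + uᵢ, so that s < t₁ < t₂ < ⋯ < t_k, and the order hypothesis is
-- stated in terms of t₁ + ⋯ + t_k.
OrderBound : (c k : ℕ) → (Vec ℕ k → PowerSeries) → Set
OrderBound c k F = ∀ us → O[q^ c ℕ.+ sum (map suc us) ] (F us)

OrderBound-∷ : ∀ {c k F} u → OrderBound c (suc k) F →
               OrderBound (c ℕ.+ suc u) k (F ∘ (u ∷_))
OrderBound-∷ {c} {F = F} u hF us =
  subst (λ m → O[q^ m ] (F (u ∷ us)))
        (sym (ℕ.+-assoc c (suc u) (sum (map suc us)))) (hF (u ∷ us))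

∑-increasing : ∀ {c} k (s : ℕ) (F : Vec ℕ k → PowerSeries) →
               .(OrderBound c k F) → PowerSeries
O-∑-increasing : ∀ {c} k s F (hF : OrderBound c k F) →
                 O[q^ c ℕ.+ k ] (∑-increasing k s F hF)

∑-increasing zero    s F hF = F []
∑-increasing (suc k) s F hF =
  ∑^∞-from s (λ u → ∑-increasing k (suc u) (F ∘ (u ∷_)) (OrderBound-∷ u hF))
    (λ u → O-≤ (ℕ.≤-trans (ℕ.n≤1+n u) (ℕ.≤-trans (ℕ.m≤n+m (suc u) _) (ℕ.m≤m+n _ k)))
               (O-∑-increasing k (suc u) (F ∘ (u ∷_)) (OrderBound-∷ u hF)))

O-∑-increasing     zero    s F hF = hF []
O-∑-increasing {c} (suc k) s F hF n n<c+1+k = ∑-zero {suc n} λ i →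
  let u = s ℕ.+ toℕ i in
  O-≤ (subst (c ℕ.+ suc k ≤_) (sym (ℕ.+-assoc c (suc u) k))
        (ℕ.+-monoʳ-≤ c (s≤s (ℕ.m≤n+m k u))))
      (O-∑-increasing k (suc u) (F ∘ (u ∷_)) (OrderBound-∷ u hF)) n n<c+1+k

A-denominator : ∀ {k} → Vec ℕ k → PowerSeries
A-denominator []       = 1ˢ
A-denominator (u ∷ us) = (1ˢ -ˢ q^ suc u) ^ˢ 2 *ˢ A-denominator us

A-denominator-0 : ∀ {k} (us : Vec ℕ k) → A-denominator us 0 ≡ 1ℤ
A-denominator-0 []       = refl
A-denominator-0 (u ∷ us) = cong (λ c → 1ℤ ℤ.* c ℤ.+ 0ℤ) (A-denominator-0 us)

A-term : ∀ {k} → Vec ℕ k → PowerSeries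
A-term us = q^ (sum (map suc us)) *ˢ recip (A-denominator us) (A-denominator-0 us)

A-term-order : ∀ k → OrderBound 0 k A-term
A-term-order k us =
  O-*ˡ (recip (A-denominator us) (A-denominator-0 us)) (O-q^ (sum (map suc us)))

A : ℕ → PowerSeries
A k = ∑-increasing k 0 A-term (A-term-order k)

O-A : ∀ k → O[q^ k ] (A k)
O-A k = O-∑-increasing k 0 A-term (A-term-order k)

-- In the range k ≥ |α| of the sum, k + α ≥ 0 and so ∣ + k + α ∣ is k + α.
binomialA-term : ℤ → ℕ → PowerSeries
binomialA-term α k = + ((2 ℕ.* k) C ∣ + k ℤ.+ α ∣) • A k

O-binomialA-term : ∀ α k → O[q^ k ] (binomialA-term α k)
O-binomialA-term α k = O-• (+ ((2 ℕ.* k) C ∣ + k ℤ.+ α ∣)) (O-A k)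

binomialA : ℤ → PowerSeries
binomialA α = ∑^∞-from ∣ α ∣ (binomialA-term α) (O-binomialA-term α)

-- The pairs (α , β) with α + 2β = γ are indexed by β, with α = γ - 2β.
S : ℤ → PowerSeries
S γ = ∑^ℤ (λ β → (-1ℤ ℤ.^ ∣ β ∣) • (binomialA (γ ℤ.- + 2 ℤ.* β) *ˢ binomialA β))
          (λ β → O-• (-1ℤ ℤ.^ ∣ β ∣)
                     (O-*ʳ (binomialA (γ ℤ.- + 2 ℤ.* β))
                           (O-∑^∞-from (O-binomialA-term β))))

-- Formal Laurent series: q^⟨ e ⟩ f is q^e · f.  This representation is not
-- unique, so equality is equality of all coefficients.
infix 5 q^⟨_⟩_
infix 4 _≈_

record LaurentSeries : Set where
  constructor q^⟨_⟩_
  field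
    exponent : ℤ
    series   : PowerSeries

coeff : LaurentSeries → ℤ → ℤ
coeff (q^⟨ e ⟩ f) m with m ℤ.- e
... | + i      = f i
... | -[1+ _ ] = 0ℤ

_≈_ : LaurentSeries → LaurentSeries → Set
x ≈ y = ∀ m → coeff x m ≡ coeff y m

{-# OPTIONS --safe #-}
-- With T(α) = α(α-1)/2, the series binomialA α is the coefficient B_α of z^α in
-- ∏_{n≥1} (1 + z q^n)(1 + z⁻¹ q^n) / (1 - q^n)², because ∑ A_k x^k = ∏ (1 + x q^n / (1 - q^n)²)
-- and x = z + 2 + z⁻¹.  The triple product identity gives B_α + B_{α-1} = q^{T(α)} / (q;q)_∞³.
-- Applied to the first factor of ∑_β (-1)^β B_{γ-2β} B_β, and after a shift β ↦ β + 1 to the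
-- second one, it yields
--   (q;q)_∞⁶ (S_γ + S_{γ-1} - S_{γ-2} - S_{γ-3}) = ∑_β (-1)^β q^{T(γ-2β) + T(β)}.
-- Translating β by 2n completes the square: for γ = 5n + 1 and γ = 5n the sum is a power of q times
-- ∑_m (-1)^m q^{5 T(m) + c m} with c = 1 and c = 3, a triple product again.
--
-- All identities are proved modulo q^M for every M, where infinite sums and products are finite.
-- The triple product is the limit of the closed form of the coefficients of
-- ∏_{i<n} (1 + z p^i) ∏_{i<m} (1 + z⁻¹ p^(i+1)).
module Submission where

open import Defs
open import Algebra.Bundles using (CommutativeRing)
open import Algebra.Solver.Ring.AlmostCommutativeRing using (fromCommutativeRing; _-Raw-AlmostCommutative⟶_)
import Algebra.Solver.Ring as RingSolver
open import Algebra.Structures using (IsCommutativeRing)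
open import Data.Fin.Base using (toℕ)
open import Data.Integer.Base as ℤ using (ℤ; +_; -[1+_]; 0ℤ; 1ℤ; -1ℤ; ∣_∣)
import Data.Integer.DivMod as ℤ
import Data.Integer.Properties as ℤ
open import Algebra.Properties.Monoid.Sum ℤ.+-0-monoid using (sum-syntax)
open import Data.Integer.Solver renaming (module +-*-Solver to ℤSolver)
open import Data.Integer.Tactic.RingSolver using (solve-∀)
open import Data.Maybe.Base using (Maybe; just; nothing)
open import Data.Nat.Base as ℕ using (ℕ; zero; suc; _∸_; _<_; _≤_; z≤n; s≤s)
open import Data.Nat.Combinatorics using (_C_; nCk+nC[k+1]≡[n+1]C[k+1])
import Data.Nat.DivMod as ℕ
import Data.Nat.Properties as ℕ
open import Data.Nat.Solver renaming (module +-*-Solver to ℕSolver)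
open import Data.Product.Base using (_×_; _,_)
open import Data.Sum.Base using (inj₁; inj₂)
open import Data.Vec.Base using (Vec; []; _∷_; map; sum)
open import Function.Base using (_∘_)
open import Level using (0ℓ)
import Relation.Binary.Reasoning.Setoid as SetoidReasoning
open import Relation.Binary.PropositionalEquality
open import Relation.Nullary using (contradiction; yes; no)

-- Adding neighbours is multiplication by 1 + z, which supplies the factor i = 0 that the product
-- for B lacks; only then does the triple product apply. With B(z) = ∑ B_α z^α the generating
-- function ∑ S_γ w^γ is B(w) B(-w²), and 1 + w - w² - w³ = (1 + w)(1 - w²) supplies that factor to
-- both copies. This is the origin of the four signs. The translation is even so that (-1)^β is
-- unchanged, and it is 2n because then the cross terms of the two squares cancel. The obstacle is
-- precision. The finite triple product has Gaussian binomials as coefficients, which are far from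
-- their limit 1/(p;p)_∞ near the ends of the support; there the growth of T makes up for it.
-- Evaluation at z = -q^c needs the factor (-q^c)^(N+1) to clear negative powers of z, and
-- cancelling it costs (N+1)c digits. With N factors on either side N(c + c′) digits are known,
-- which leaves enough because c′ ≥ 1.

private
  j≡-i+[i+j] : ∀ i j → j ≡ ℤ.- i ℤ.+ (i ℤ.+ j)
  j≡-i+[i+j] = solve-∀

suc-+ : ∀ i j → (1ℤ ℤ.+ i) ℤ.+ j ≡ i ℤ.+ (1ℤ ℤ.+ j)
suc-+ = solve-∀

≤∣+∣ : ∀ {s} i j → ∣ i ∣ ℕ.+ s ≤ ∣ j ∣ → s ≤ ∣ i ℤ.+ j ∣
≤∣+∣ {s} i j i+s≤j = ℕ.+-cancelˡ-≤ (∣ i ∣) s _ (begin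
  ∣ i ∣ ℕ.+ s                     ≤⟨ i+s≤j ⟩
  ∣ j ∣                           ≡⟨ cong ∣_∣ (j≡-i+[i+j] i j) ⟩
  ∣ ℤ.- i ℤ.+ (i ℤ.+ j) ∣         ≤⟨ ℤ.∣i+j∣≤∣i∣+∣j∣ (ℤ.- i) (i ℤ.+ j) ⟩
  ∣ ℤ.- i ∣ ℕ.+ ∣ i ℤ.+ j ∣       ≡⟨ cong (ℕ._+ ∣ i ℤ.+ j ∣) (ℤ.∣-i∣≡∣i∣ i) ⟩
  ∣ i ∣ ℕ.+ ∣ i ℤ.+ j ∣           ∎)
  where open ℕ.≤-Reasoning

-- Triangular numbers, and the support of the finite triple product

triangle : ℕ → ℕ
triangle zero    = 0
triangle (suc k) = triangle k ℕ.+ k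

-- T α = α (α - 1) / 2
T : ℤ → ℕ
T (+ k)    = triangle k
T -[1+ k ] = triangle (suc (suc k))

T-suc : ∀ α → + T (ℤ.suc α) ≡ + T α ℤ.+ α
T-suc (+ k)         = refl
T-suc -[1+ zero ]   = refl
T-suc -[1+ suc k ]  = lemma (+ triangle (suc (suc k))) (+ suc (suc k))
  where
  lemma : ∀ i j → i ≡ i ℤ.+ j ℤ.+ ℤ.- j
  lemma = solve-∀

2T : ∀ α → + 2 ℤ.* + T α ≡ α ℤ.* α ℤ.- α
2T (+ k)    = 2triangle k
  where
  lemma : ∀ i → i ℤ.* i ℤ.- i ℤ.+ + 2 ℤ.* i ≡ (1ℤ ℤ.+ i) ℤ.* (1ℤ ℤ.+ i) ℤ.- (1ℤ ℤ.+ i)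
  lemma = solve-∀
  2triangle : ∀ k → + 2 ℤ.* + triangle k ≡ + k ℤ.* + k ℤ.- + k
  2triangle zero    = refl
  2triangle (suc k) = trans (ℤ.*-distribˡ-+ (+ 2) (+ triangle k) (+ k))
      (trans (cong (ℤ._+ + 2 ℤ.* + k) (2triangle k)) (lemma (+ k)))
2T -[1+ k ] = trans (2T (+ suc (suc k))) (lemma (+ suc k))
  where
  lemma : ∀ i → (1ℤ ℤ.+ i) ℤ.* (1ℤ ℤ.+ i) ℤ.- (1ℤ ℤ.+ i) ≡ ℤ.- i ℤ.* ℤ.- i ℤ.- ℤ.- i
  lemma = solve-∀

-- The exponent balance for a new factor 1 + z⁻¹ p^m in `E-closed`: at α = J - m its contribution
-- p^m p^T(α+1) is p^T(α) times the weight p^J of a q-Pascal rule.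
m+T[suc] : ∀ m J → m ℕ.+ T (ℤ.suc (J ℤ.⊖ m)) ≡ T (J ℤ.⊖ m) ℕ.+ J
m+T[suc] m J = ℤ.+-injective (begin
  + m ℤ.+ + T (ℤ.suc (J ℤ.⊖ m))                      ≡⟨ cong (λ t → + m ℤ.+ t) (T-suc (J ℤ.⊖ m)) ⟩
  + m ℤ.+ (+ T (J ℤ.⊖ m) ℤ.+ (J ℤ.⊖ m))              ≡⟨ cong (λ i → + m ℤ.+ (+ T (J ℤ.⊖ m) ℤ.+ i)) (ℤ.m-n≡m⊖n J m) ⟨
  + m ℤ.+ (+ T (J ℤ.⊖ m) ℤ.+ (+ J ℤ.- + m))          ≡⟨ lemma (+ m) (+ T (J ℤ.⊖ m)) (+ J) ⟩
  + T (J ℤ.⊖ m) ℤ.+ + J                              ∎)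
  where
  open ≡-Reasoning
  lemma : ∀ m t j → m ℤ.+ (t ℤ.+ (j ℤ.- m)) ≡ t ℤ.+ j
  lemma = solve-∀

-- The same balance for a new factor 1 + z p^n, where the weight is p^K.
n+T[pred] : ∀ n m J K → J ℕ.+ K ≡ suc n ℕ.+ m → n ℕ.+ T (ℤ.pred (J ℤ.⊖ m)) ≡ T (J ℤ.⊖ m) ℕ.+ K
n+T[pred] n m J K J+K≡1+n+m = ℤ.+-injective (begin
  + n ℤ.+ + T α′                                     ≡⟨ lemma₁ (+ n) (+ T α′) α ⟩
  + n ℤ.+ (+ T α′ ℤ.+ α′) ℤ.+ (1ℤ ℤ.- α)             ≡⟨ cong (λ t → + n ℤ.+ t ℤ.+ (1ℤ ℤ.- α)) (T-suc α′) ⟨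
  + n ℤ.+ + T (ℤ.suc α′) ℤ.+ (1ℤ ℤ.- α)              ≡⟨ cong₂ (λ β γ → + n ℤ.+ + T β ℤ.+ (1ℤ ℤ.- γ))
      (ℤ.suc-pred α) (sym (ℤ.m-n≡m⊖n J m)) ⟩
  + n ℤ.+ + T α ℤ.+ (1ℤ ℤ.- (+ J ℤ.- + m))           ≡⟨ lemma₂ (+ n) (+ T α) (+ J) (+ m) ⟩
  + T α ℤ.+ (1ℤ ℤ.+ + n ℤ.+ + m) ℤ.- + J             ≡⟨ cong (λ x → + T α ℤ.+ + x ℤ.- + J) J+K≡1+n+m ⟨
  + T α ℤ.+ (+ J ℤ.+ + K) ℤ.- + J                    ≡⟨ lemma₃ (+ T α) (+ J) (+ K) ⟩
  + T α ℤ.+ + K                                      ∎)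
  where
  open ≡-Reasoning
  α = J ℤ.⊖ m
  α′ = ℤ.pred α
  lemma₁ : ∀ n t a → n ℤ.+ t ≡ n ℤ.+ (t ℤ.+ (-1ℤ ℤ.+ a)) ℤ.+ (1ℤ ℤ.- a)
  lemma₁ = solve-∀
  lemma₂ : ∀ n t j m → n ℤ.+ t ℤ.+ (1ℤ ℤ.- (j ℤ.- m)) ≡ t ℤ.+ (1ℤ ℤ.+ n ℤ.+ m) ℤ.- j
  lemma₂ = solve-∀
  lemma₃ : ∀ t j k → t ℤ.+ (j ℤ.+ k) ℤ.- j ≡ t ℤ.+ k
  lemma₃ = solve-∀

triangle-≥ : ∀ k → k ≤ triangle (suc k)
triangle-≥ k = ℕ.m≤n+m k (triangle k)

∣α∣≤1+T : ∀ α → ∣ α ∣ ≤ suc (T α)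
∣α∣≤1+T (+ zero)  = z≤n
∣α∣≤1+T (+ suc k) = s≤s (triangle-≥ k)
∣α∣≤1+T -[1+ k ]  = ℕ.m≤n⇒m≤1+n (triangle-≥ (suc k))

suc-⊖-suc : ∀ j m → ℤ.suc (j ℤ.⊖ suc m) ≡ j ℤ.⊖ m
suc-⊖-suc j m = trans (cong ℤ.suc (sym (ℤ.m-n≡m⊖n j (suc m)))) (trans (lemma (+ j) (+ m)) (ℤ.m-n≡m⊖n j m))
  where
  lemma : ∀ i j → 1ℤ ℤ.+ (i ℤ.- (1ℤ ℤ.+ j)) ≡ i ℤ.- j
  lemma = solve-∀

pred-suc-⊖ : ∀ j m → ℤ.pred (suc j ℤ.⊖ m) ≡ j ℤ.⊖ m
pred-suc-⊖ j m = trans (cong ℤ.pred (sym (ℤ.m-n≡m⊖n (suc j) m))) (trans (lemma (+ j) (+ m)) (ℤ.m-n≡m⊖n j m))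
  where
  lemma : ∀ i j → -1ℤ ℤ.+ ((1ℤ ℤ.+ i) ℤ.- j) ≡ i ℤ.- j
  lemma = solve-∀

pred-0⊖ : ∀ m → ℤ.pred (0 ℤ.⊖ m) ≡ -[1+ m ]
pred-0⊖ zero    = refl
pred-0⊖ (suc m) = refl

-- The interval [-m, n] is the support of `E n m`. Inside it, J and K are the distances to its lower
-- and upper end, and also the two lower indices of the Gaussian binomial found there.
data Position (n m : ℕ) : ℤ → Set where
  below  : ∀ i → Position n m -[1+ m ℕ.+ i ]
  above  : ∀ i → Position n m (+ suc (n ℕ.+ i))
  within : ∀ J K → J ℕ.+ K ≡ n ℕ.+ m → Position n m (J ℤ.⊖ m)

position : ∀ n m α → Position n m α
position n m (+ k) with ℕ.<-≤-connex n k
... | inj₁ n<k = subst (Position n m ∘ +_) (ℕ.m+[n∸m]≡n n<k) (above (k ∸ suc n))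
... | inj₂ k≤n = subst (Position n m) (trans (ℤ.≤-⊖ (ℕ.m≤n+m m k)) (cong +_ (ℕ.m+n∸n≡m k m)))
  (within (k ℕ.+ m) (n ∸ k) (begin
    k ℕ.+ m ℕ.+ (n ∸ k)   ≡⟨ ℕ.+-assoc k m (n ∸ k) ⟩
    k ℕ.+ (m ℕ.+ (n ∸ k)) ≡⟨ cong (k ℕ.+_) (ℕ.+-comm m (n ∸ k)) ⟩
    k ℕ.+ (n ∸ k ℕ.+ m)   ≡⟨ ℕ.+-assoc k (n ∸ k) m ⟨
    k ℕ.+ (n ∸ k) ℕ.+ m   ≡⟨ cong (ℕ._+ m) (ℕ.m+[n∸m]≡n k≤n) ⟩
    n ℕ.+ m               ∎))
  where open ≡-Reasoning
position n m -[1+ k ] with ℕ.<-≤-connex k m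
... | inj₂ m≤k = subst (Position n m ∘ -[1+_]) (ℕ.m+[n∸m]≡n m≤k) (below (k ∸ m))
... | inj₁ k<m = subst (Position n m) (trans (ℤ.⊖-≤ (ℕ.m∸n≤m m (suc k))) (cong (ℤ.-_ ∘ +_) (ℕ.m∸[m∸n]≡n k<m)))
  (within (m ∸ suc k) (n ℕ.+ suc k) (begin
    m ∸ suc k ℕ.+ (n ℕ.+ suc k)   ≡⟨ ℕ.+-comm (m ∸ suc k) (n ℕ.+ suc k) ⟩
    n ℕ.+ suc k ℕ.+ (m ∸ suc k)   ≡⟨ ℕ.+-assoc n (suc k) (m ∸ suc k) ⟩
    n ℕ.+ (suc k ℕ.+ (m ∸ suc k)) ≡⟨ cong (n ℕ.+_) (ℕ.m+[n∸m]≡n k<m) ⟩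
    n ℕ.+ m                       ∎))
  where open ≡-Reasoning

-- For small J, `poch J` approximates (p;p)_∞ only to about J + 1 powers of p. This bound says that
-- T α is then large enough to provide the missing ones.
m≤1+T+J : ∀ m J → m ≤ T (J ℤ.⊖ m) ℕ.+ suc J
m≤1+T+J m J = ℕ.≤-trans (ℕ.m≤m+n m (T (ℤ.suc (J ℤ.⊖ m))))
    (ℕ.≤-trans (ℕ.≤-reflexive (m+T[suc] m J)) (ℕ.+-monoʳ-≤ (T (J ℤ.⊖ m)) (ℕ.n≤1+n J)))

n≤1+T+K : ∀ n m J K → J ℕ.+ K ≡ n ℕ.+ m → n ≤ T (J ℤ.⊖ m) ℕ.+ suc K
n≤1+T+K n m J K J+K≡n+m = ℕ.≤-trans (ℕ.m≤m+n n (T (ℤ.pred (J ℤ.⊖ m))))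
  (ℕ.≤-reflexive (n+T[pred] n m J (suc K) (trans (ℕ.+-suc J K) (cong suc J+K≡n+m))))

sgn : ℤ → ℤ
sgn α = -1ℤ ℤ.^ ∣ α ∣

-1^k*-1^k≡1 : ∀ k → (-1ℤ ℤ.^ k) ℤ.* (-1ℤ ℤ.^ k) ≡ 1ℤ
-1^k*-1^k≡1 zero    = refl
-1^k*-1^k≡1 (suc k) = trans (lemma (-1ℤ ℤ.^ k)) (-1^k*-1^k≡1 k)
  where
  lemma : ∀ i → (-1ℤ ℤ.* i) ℤ.* (-1ℤ ℤ.* i) ≡ i ℤ.* i
  lemma = solve-∀

-- The precision budget of `theta`: N(c + c′) digits are known, (N+1)c are spent on cancelling
-- a^(N+1), and M remain.
[1+N]c+M≤N[c+c′] : ∀ {c c′ M N} → 1 ≤ c′ → c ℕ.+ M ≤ N → suc N ℕ.* c ℕ.+ M ≤ N ℕ.* (c ℕ.+ c′)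
[1+N]c+M≤N[c+c′] {c} {c′} {M} {N} 1≤c′ c+M≤N = begin
  c ℕ.+ N ℕ.* c ℕ.+ M           ≡⟨ cong (ℕ._+ M) (ℕ.+-comm c (N ℕ.* c)) ⟩
  N ℕ.* c ℕ.+ c ℕ.+ M           ≡⟨ ℕ.+-assoc (N ℕ.* c) c M ⟩
  N ℕ.* c ℕ.+ (c ℕ.+ M)         ≤⟨ ℕ.+-monoʳ-≤ (N ℕ.* c) c+M≤N ⟩
  N ℕ.* c ℕ.+ N                 ≡⟨ cong (N ℕ.* c ℕ.+_) (ℕ.*-identityʳ N) ⟨
  N ℕ.* c ℕ.+ N ℕ.* 1           ≤⟨ ℕ.+-monoʳ-≤ (N ℕ.* c) (ℕ.*-monoʳ-≤ N 1≤c′) ⟩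
  N ℕ.* c ℕ.+ N ℕ.* c′          ≡⟨ ℕ.*-distribˡ-+ N c c′ ⟨
  N ℕ.* (c ℕ.+ c′)              ∎
  where open ℕ.≤-Reasoning

-- The coefficients of (z + 2 + z⁻¹)^k as binomial coefficients

-- bin k α is the coefficient of z^α in (z + 2 + z⁻¹)^k.
bin : ℕ → ℤ → ℤ
bin zero    (+ zero)  = 1ℤ
bin zero    (+ suc _) = 0ℤ
bin zero    -[1+ _ ]  = 0ℤ
bin (suc k) α         = (bin k (ℤ.pred α) ℤ.+ bin k (ℤ.suc α)) ℤ.+ (bin k α ℤ.+ bin k α)

private
  0+0+0 : ∀ {i j k} → i ≡ 0ℤ → j ≡ 0ℤ → k ≡ 0ℤ → (i ℤ.+ j) ℤ.+ (k ℤ.+ k) ≡ 0ℤ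
  0+0+0 refl refl refl = refl

bin-zero⁻ : ∀ k i → bin k -[1+ k ℕ.+ i ] ≡ 0ℤ
bin-zero⁻ zero    i = refl
bin-zero⁻ (suc k) i = 0+0+0
  (trans (cong (bin k ∘ -[1+_]) (sym (trans (ℕ.+-suc k (suc i)) (cong suc (ℕ.+-suc k i))))) (bin-zero⁻ k (suc (suc i))))
  (bin-zero⁻ k i)
  (trans (cong (bin k ∘ -[1+_]) (sym (ℕ.+-suc k i))) (bin-zero⁻ k (suc i)))

bin-zero⁺ : ∀ k i → bin k (+ suc (k ℕ.+ i)) ≡ 0ℤ
bin-zero⁺ zero    i = refl
bin-zero⁺ (suc k) i = 0+0+0
  (bin-zero⁺ k i)
  (trans (cong (bin k ∘ +_ ∘ suc) (sym (trans (ℕ.+-suc k (suc i)) (cong suc (ℕ.+-suc k i)))))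
      (bin-zero⁺ k (suc (suc i))))
  (trans (cong (bin k ∘ +_ ∘ suc) (sym (ℕ.+-suc k i))) (bin-zero⁺ k (suc i)))

bin-zero : ∀ k α → k < ∣ α ∣ → bin k α ≡ 0ℤ
bin-zero k (+ suc m) (s≤s k≤m) = trans (cong (bin k ∘ +_ ∘ suc) (sym (ℕ.m+[n∸m]≡n k≤m))) (bin-zero⁺ k (m ∸ k))
bin-zero k -[1+ m ]  (s≤s k≤m) = trans (cong (bin k ∘ -[1+_]) (sym (ℕ.m+[n∸m]≡n k≤m))) (bin-zero⁻ k (m ∸ k))

private
  previous : (ℕ → ℕ) → ℕ → ℕ
  previous f zero    = 0
  previous f (suc j) = f j

  pascal : ∀ n j → suc n C j ≡ previous (n C_) j ℕ.+ n C j
  pascal n zero    = refl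
  pascal n (suc j) = sym (nCk+nC[k+1]≡[n+1]C[k+1] n j)

  pascal² : ∀ n j → suc (suc n) C j ≡ (previous (previous (n C_)) j ℕ.+ n C j) ℕ.+
      (previous (n C_) j ℕ.+ previous (n C_) j)
  pascal² n j = trans (pascal (suc n) j) (trans (cong₂ ℕ._+_ (lemma j) (pascal n j))
    (solve 3 (λ a b c → (a :+ b) :+ (b :+ c) := (a :+ c) :+ (b :+ b)) refl (previous (previous (n C_)) j)
        (previous (n C_) j) (n C j)))
    where
    open ℕSolver
    lemma : ∀ j → previous (suc n C_) j ≡ previous (previous (n C_)) j ℕ.+ previous (n C_) j
    lemma zero    = refl
    lemma (suc j) = pascal n j

-- Since z + 2 + z⁻¹ = z⁻¹ (1 + z)², the k-th power is z^(-k) (1 + z)^(2k): one step of the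
-- recursion of `bin` is two steps of Pascal's rule, and exponents are displaced by k.
bin-⊖ : ∀ k j → bin k (j ℤ.⊖ k) ≡ + ((2 ℕ.* k) C j)
bin-⊖ zero    zero    = refl
bin-⊖ zero    (suc j) = refl
bin-⊖ (suc k) j       = begin
  (bin k (ℤ.pred (j ℤ.⊖ suc k)) ℤ.+ bin k (ℤ.suc (j ℤ.⊖ suc k))) ℤ.+ (bin k (j ℤ.⊖ suc k) ℤ.+ bin k (j ℤ.⊖ suc k))
    ≡⟨ cong₂ ℤ._+_ (cong₂ ℤ._+_ (pred-term j) (trans (cong (bin k) (suc-⊖-suc j k)) (bin-⊖ k j)))
        (cong₂ ℤ._+_ (term j) (term j)) ⟩
  + ((previous (previous (n C_)) j ℕ.+ n C j) ℕ.+ (previous (n C_) j ℕ.+ previous (n C_) j))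
    ≡⟨ cong +_ (pascal² n j) ⟨
  + (suc (suc n) C j)
    ≡⟨ cong (λ m → + (suc m C j)) (ℕ.+-suc k (k ℕ.+ 0)) ⟨
  + ((2 ℕ.* suc k) C j) ∎
  where
  open ≡-Reasoning
  n = 2 ℕ.* k
  bin-k-[1+k] : bin k -[1+ k ] ≡ 0ℤ
  bin-k-[1+k] = bin-zero k -[1+ k ] ℕ.≤-refl
  term : ∀ j → bin k (j ℤ.⊖ suc k) ≡ + previous (n C_) j
  term zero    = bin-k-[1+k]
  term (suc j) = trans (cong (bin k) (ℤ.[1+m]⊖[1+n]≡m⊖n j k)) (bin-⊖ k j)
  pred-term : ∀ j → bin k (ℤ.pred (j ℤ.⊖ suc k)) ≡ + previous (previous (n C_)) j
  pred-term zero          = bin-zero k -[1+ suc k ] (ℕ.n≤1+n (suc k))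
  pred-term (suc zero)    = trans (cong (bin k) (trans (pred-suc-⊖ 0 (suc k)) refl)) bin-k-[1+k]
  pred-term (suc (suc j)) = trans (cong (bin k) (trans (pred-suc-⊖ (suc j) (suc k)) (ℤ.[1+m]⊖[1+n]≡m⊖n j k)))
      (bin-⊖ k j)

bin≡C : ∀ k α → ∣ α ∣ ≤ k → bin k α ≡ + ((2 ℕ.* k) C ∣ + k ℤ.+ α ∣)
bin≡C k α ∣α∣≤k with position k k α
... | below i      = contradiction (ℕ.≤-trans (s≤s (ℕ.m≤m+n k i)) ∣α∣≤k) ℕ.1+n≰n
... | above i      = contradiction (ℕ.≤-trans (s≤s (ℕ.m≤m+n k i)) ∣α∣≤k) ℕ.1+n≰n
... | within J K _ = trans (bin-⊖ k J)
    (cong (λ i → + ((2 ℕ.* k) C ∣ i ∣))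
        (sym (trans (cong (λ i → + k ℤ.+ i) (sym (ℤ.m-n≡m⊖n J k))) (lemma (+ k) (+ J)))))
  where
  lemma : ∀ i j → i ℤ.+ (j ℤ.- i) ≡ j
  lemma = solve-∀

-- Multiplicativity of the sign (-1)^β

sgn-suc : ∀ β → sgn (ℤ.suc β) ≡ -1ℤ ℤ.* sgn β
sgn-suc (+ k)        = refl
sgn-suc -[1+ zero ]  = refl
sgn-suc -[1+ suc k ] = lemma (-1ℤ ℤ.^ suc k)
  where
  lemma : ∀ i → i ≡ -1ℤ ℤ.* (-1ℤ ℤ.* i)
  lemma = solve-∀

sgn-+ : ∀ i j → sgn (i ℤ.+ j) ≡ sgn i ℤ.* sgn j
sgn-+ (+ k)    j = sgn-+⁺ k
  where
  sgn-+⁺ : ∀ k → sgn (+ k ℤ.+ j) ≡ sgn (+ k) ℤ.* sgn j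
  sgn-+⁺ zero    = trans (cong sgn (ℤ.+-identityˡ j)) (sym (ℤ.*-identityˡ (sgn j)))
  sgn-+⁺ (suc k) = begin
    sgn (+ suc k ℤ.+ j)                     ≡⟨ cong sgn (ℤ.+-assoc 1ℤ (+ k) j) ⟩
    sgn (ℤ.suc (+ k ℤ.+ j))                 ≡⟨ sgn-suc (+ k ℤ.+ j) ⟩
    -1ℤ ℤ.* sgn (+ k ℤ.+ j)                 ≡⟨ cong (λ s → -1ℤ ℤ.* s) (sgn-+⁺ k) ⟩
    -1ℤ ℤ.* (sgn (+ k) ℤ.* sgn j)           ≡⟨ ℤ.*-assoc -1ℤ (sgn (+ k)) (sgn j) ⟨
    sgn (+ suc k) ℤ.* sgn j                 ∎
    where open ≡-Reasoning
sgn-+ -[1+ k ] j = sgn-+⁻ k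
  where
  lemma : ∀ i → i ≡ -1ℤ ℤ.* (-1ℤ ℤ.* i)
  lemma = solve-∀
  step : ∀ β → sgn β ≡ -1ℤ ℤ.* sgn (ℤ.suc β)
  step β = trans (lemma (sgn β)) (cong (λ s → -1ℤ ℤ.* s) (sym (sgn-suc β)))
  sgn-+⁻ : ∀ k → sgn (-[1+ k ] ℤ.+ j) ≡ sgn -[1+ k ] ℤ.* sgn j
  sgn-+⁻ zero    = begin
    sgn (ℤ.pred j)                          ≡⟨ step (ℤ.pred j) ⟩
    -1ℤ ℤ.* sgn (ℤ.suc (ℤ.pred j))          ≡⟨ cong (λ i → -1ℤ ℤ.* sgn i) (ℤ.suc-pred j) ⟩
    -1ℤ ℤ.* sgn j                           ∎
    where open ≡-Reasoning
  sgn-+⁻ (suc k) = begin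
    sgn (-[1+ suc k ] ℤ.+ j)                ≡⟨ step (-[1+ suc k ] ℤ.+ j) ⟩
    -1ℤ ℤ.* sgn (ℤ.suc (-[1+ suc k ] ℤ.+ j)) ≡⟨ cong (λ i → -1ℤ ℤ.* sgn i) (sym (ℤ.+-assoc 1ℤ -[1+ suc k ] j)) ⟩
    -1ℤ ℤ.* sgn (-[1+ k ] ℤ.+ j)            ≡⟨ cong (λ s → -1ℤ ℤ.* s) (sgn-+⁻ k) ⟩
    -1ℤ ℤ.* (sgn -[1+ k ] ℤ.* sgn j)        ≡⟨ ℤ.*-assoc -1ℤ (sgn -[1+ k ]) (sgn j) ⟨
    sgn -[1+ suc k ] ℤ.* sgn j              ∎
    where open ≡-Reasoning

sgn-2+ : ∀ n m → sgn (n ℤ.+ n ℤ.+ m) ≡ sgn m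
sgn-2+ n m = begin
  sgn (n ℤ.+ n ℤ.+ m)          ≡⟨ sgn-+ (n ℤ.+ n) m ⟩
  sgn (n ℤ.+ n) ℤ.* sgn m      ≡⟨ cong (ℤ._* sgn m) (trans (sgn-+ n n) (-1^k*-1^k≡1 ∣ n ∣)) ⟩
  1ℤ ℤ.* sgn m                 ≡⟨ ℤ.*-identityˡ (sgn m) ⟩
  sgn m                        ∎
  where open ≡-Reasoning

halve : ∀ {i} E → i ≡ + 2 ℤ.* + E → i ℤ./ + 2 ≡ + E
halve {i} E i≡2E = begin
  i ℤ./ + 2                  ≡⟨ cong (ℤ._/ + 2) (trans i≡2E (trans (sym (ℤ.pos-* 2 E)) (cong +_ (ℕ.*-comm 2 E)))) ⟩
  + (E ℕ.* 2) ℤ./ + 2        ≡⟨ ℤ.div-pos-is-/ℕ (+ (E ℕ.* 2)) 2 ⟩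
  + (E ℕ.* 2 ℕ./ 2)          ≡⟨ cong +_ (ℕ.m*n/n≡m E 2) ⟩
  + E                        ∎
  where open ≡-Reasoning

-- The ring of power series modulo q^M

-- A sum over `Fin` unfolds at its first index, so (f *ˢ g) (suc n) is by definition f 0 times g
-- (suc n) plus (shift f *ˢ g) n. The ring laws below are inductions along this recursion.
shift : PowerSeries → PowerSeries
shift f n = f (suc n)

*ˢ-cong-mod : ∀ {M f f′ g g′} → f ≡ f′ [mod-q^ M ] → g ≡ g′ [mod-q^ M ] → f *ˢ g ≡ f′ *ˢ g′ [mod-q^ M ]
*ˢ-cong-mod p r zero n<M = cong (ℤ._+ 0ℤ) (cong₂ ℤ._*_ (p 0 n<M) (r 0 n<M))
*ˢ-cong-mod {suc M} {f} {f′} {g} {g′} p r (suc n) (s≤s n<M) = cong₂ ℤ._+_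
  (cong₂ ℤ._*_ (p 0 (s≤s z≤n)) (r (suc n) (s≤s n<M)))
  (*ˢ-cong-mod {M} {shift f} {shift f′} {g} {g′} (λ i i<M → p (suc i) (s≤s i<M))
      (λ i i<M → r i (ℕ.m<n⇒m<1+n i<M)) n n<M)

*ˢ-distribʳ : ∀ h f g → (f +ˢ g) *ˢ h ≗ f *ˢ h +ˢ g *ˢ h
*ˢ-distribʳ h f g zero = solve 3
    (λ a b c → (a :+ b) :* c :+ con 0ℤ := (a :* c :+ con 0ℤ) :+ (b :* c :+ con 0ℤ)) refl (f 0) (g 0) (h 0)
  where open ℤSolver
*ˢ-distribʳ h f g (suc n) = trans (cong (λ x → (f 0 ℤ.+ g 0) ℤ.* h (suc n) ℤ.+ x) (*ˢ-distribʳ h (shift f) (shift g) n))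
  (solve 5 (λ a b c d e → (a :+ b) :* c :+ (d :+ e) := (a :* c :+ d) :+ (b :* c :+ e)) refl
    (f 0) (g 0) (h (suc n)) ((shift f *ˢ h) n) ((shift g *ˢ h) n))
  where open ℤSolver

•-*ˢ : ∀ c f g → (c • f) *ˢ g ≗ c • (f *ˢ g)
•-*ˢ c f g zero = solve 3 (λ a b c → a :* b :* c :+ con 0ℤ := a :* (b :* c :+ con 0ℤ)) refl c (f 0) (g 0)
  where open ℤSolver
•-*ˢ c f g (suc n) = trans (cong (λ x → c ℤ.* f 0 ℤ.* g (suc n) ℤ.+ x) (•-*ˢ c (shift f) g n))
  (solve 4 (λ a b c d → a :* b :* c :+ a :* d := a :* (b :* c :+ d)) refl c (f 0) (g (suc n)) ((shift f *ˢ g) n))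
  where open ℤSolver

*ˢ-assoc : ∀ f g h → (f *ˢ g) *ˢ h ≗ f *ˢ (g *ˢ h)
*ˢ-assoc f g h zero = solve 3
    (λ a b c → (a :* b :+ con 0ℤ) :* c :+ con 0ℤ := a :* (b :* c :+ con 0ℤ) :+ con 0ℤ) refl (f 0) (g 0) (h 0)
  where open ℤSolver
*ˢ-assoc f g h (suc n) = begin
  (f 0 ℤ.* g 0 ℤ.+ 0ℤ) ℤ.* h (suc n) ℤ.+ ((f 0 • shift g +ˢ shift f *ˢ g) *ˢ h) n
    ≡⟨ cong (λ x → (f 0 ℤ.* g 0 ℤ.+ 0ℤ) ℤ.* h (suc n) ℤ.+ x) (*ˢ-distribʳ h (f 0 • shift g) (shift f *ˢ g) n) ⟩
  (f 0 ℤ.* g 0 ℤ.+ 0ℤ) ℤ.* h (suc n) ℤ.+ (((f 0 • shift g) *ˢ h) n ℤ.+ ((shift f *ˢ g) *ˢ h) n)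
    ≡⟨ cong (λ x → (f 0 ℤ.* g 0 ℤ.+ 0ℤ) ℤ.* h (suc n) ℤ.+ x)
        (cong₂ ℤ._+_ (•-*ˢ (f 0) (shift g) h n) (*ˢ-assoc (shift f) g h n)) ⟩
  (f 0 ℤ.* g 0 ℤ.+ 0ℤ) ℤ.* h (suc n) ℤ.+ (f 0 ℤ.* (shift g *ˢ h) n ℤ.+ (shift f *ˢ (g *ˢ h)) n)
    ≡⟨ solve 5 (λ a b c d e → (a :* b :+ con 0ℤ) :* c :+ (a :* d :+ e) := a :* (b :* c :+ d) :+ e) refl
         (f 0) (g 0) (h (suc n)) ((shift g *ˢ h) n) ((shift f *ˢ (g *ˢ h)) n) ⟩
  f 0 ℤ.* (g *ˢ h) (suc n) ℤ.+ (shift f *ˢ (g *ˢ h)) n ∎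
  where open ≡-Reasoning
        open ℤSolver

-- The convolution opened at its other end. This direction does not hold by definition, and
-- commutativity needs both.
*ˢ-unfoldʳ : ∀ f g n → (f *ˢ g) (suc n) ≡ (f *ˢ shift g) n ℤ.+ f (suc n) ℤ.* g 0
*ˢ-unfoldʳ f g zero = solve 4 (λ a b c d → a :* b :+ (c :* d :+ con 0ℤ) := a :* b :+ con 0ℤ :+ c :* d) refl
    (f 0) (g 1) (f 1) (g 0)
  where open ℤSolver
*ˢ-unfoldʳ f g (suc n) = trans (cong (λ x → f 0 ℤ.* g (suc (suc n)) ℤ.+ x) (*ˢ-unfoldʳ (shift f) g n))
    (sym (ℤ.+-assoc (f 0 ℤ.* g (suc (suc n))) _ _))

*ˢ-comm : ∀ f g → f *ˢ g ≗ g *ˢ f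
*ˢ-comm f g zero = cong (ℤ._+ 0ℤ) (ℤ.*-comm (f 0) (g 0))
*ˢ-comm f g (suc n) = begin
  f 0 ℤ.* g (suc n) ℤ.+ (shift f *ˢ g) n ≡⟨ cong₂ ℤ._+_ (ℤ.*-comm (f 0) _) (*ˢ-comm (shift f) g n) ⟩
  g (suc n) ℤ.* f 0 ℤ.+ (g *ˢ shift f) n ≡⟨ ℤ.+-comm _ ((g *ˢ shift f) n) ⟩
  (g *ˢ shift f) n ℤ.+ g (suc n) ℤ.* f 0 ≡⟨ *ˢ-unfoldʳ g f n ⟨
  (g *ˢ f) (suc n)                       ∎
  where open ≡-Reasoning

*ˢ-zeroˡ : ∀ {f} g → f ≗ 0ˢ → f *ˢ g ≗ 0ˢ
*ˢ-zeroˡ g f≗0 n = ∑-zero {suc n} λ i → cong (ℤ._* g (n ∸ toℕ i)) (f≗0 (toℕ i))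

*ˢ-identityˡ : ∀ f → 1ˢ *ˢ f ≗ f
*ˢ-identityˡ f zero    = trans (ℤ.+-identityʳ _) (ℤ.*-identityˡ (f 0))
*ˢ-identityˡ f (suc n) = trans (cong₂ ℤ._+_ (ℤ.*-identityˡ (f (suc n))) (*ˢ-zeroˡ f (λ _ → refl) n)) (ℤ.+-identityʳ _)

q^-+ : ∀ m n → q^ m *ˢ q^ n ≗ q^ (m ℕ.+ n)
q^-+ zero    n       = *ˢ-identityˡ (q^ n)
q^-+ (suc m) n zero    = refl
q^-+ (suc m) n (suc i) = trans (ℤ.+-identityˡ _) (q^-+ m n i)

q^-*ˢ-+ : ∀ m f n → (q^ m *ˢ f) (m ℕ.+ n) ≡ f n
q^-*ˢ-+ zero    f n = *ˢ-identityˡ f n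
q^-*ˢ-+ (suc m) f n = trans (ℤ.+-identityˡ _) (q^-*ˢ-+ m f n)

infix 4 _≋[_]_

-- A record instead of the bare function type, so that f, M and g can be recovered from the type of
-- a proof by unification.
record _≋[_]_ (f : PowerSeries) (M : ℕ) (g : PowerSeries) : Set where
  constructor mod
  field unmod : f ≡ g [mod-q^ M ]
open _≋[_]_

-- Opaque, because a transparent f *ˢ g unfolds to its coefficients and f and g can no longer be inferred.
module Series where
  infixl 7 _*_
  infixl 6 _+_
  infix  8 -_

  opaque
    _+_ _*_ : PowerSeries → PowerSeries → PowerSeries
    _+_ = _+ˢ_
    _*_ = _*ˢ_

    -_ : PowerSeries → PowerSeries
    - f = -1ℤ • f

    ι : ℤ → PowerSeries
    ι c = c • 1ˢ

  infixl 6 _-_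
  _-_ : PowerSeries → PowerSeries → PowerSeries
  f - g = f + - g

  0# 1# : PowerSeries
  0# = ι 0ℤ
  1# = ι 1ℤ

module RogersRamanujan where
  open Series

  opaque
    unfolding _+_

    1•1*f : ∀ f → (1ℤ • 1ˢ) *ˢ f ≗ f
    1•1*f f n = trans (•-*ˢ 1ℤ 1ˢ f n) (trans (ℤ.*-identityˡ _) (*ˢ-identityˡ f n))

    isCommutativeRing : ∀ M → IsCommutativeRing _≋[ M ]_ _+_ _*_ -_ 0# 1#
    isCommutativeRing M = record
        { isRing = record
          { +-isAbelianGroup = record
            { isGroup = record
              { isMonoid = record
                { isSemigroup = record
                  { isMagma = record
                    { isEquivalence = record
                      { refl = mod λ _ _ → refl
                      ; sym = λ (mod p) → mod λ n n<M → sym (p n n<M)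
                      ; trans = λ (mod p) (mod r) → mod λ n n<M → trans (p n n<M) (r n n<M) }
                    ; ∙-cong = λ (mod p) (mod r) → mod λ n n<M → cong₂ ℤ._+_ (p n n<M) (r n n<M) }
                  ; assoc = λ f g h → mod λ n _ → ℤ.+-assoc (f n) (g n) (h n) }
                ; identity = (λ f → mod λ n _ → ℤ.+-identityˡ (f n)) , (λ f → mod λ n _ → ℤ.+-identityʳ (f n)) }
              ; inverse = (λ f → mod λ n _ → trans (cong (ℤ._+ f n) (ℤ.-1*i≡-i (f n))) (ℤ.+-inverseˡ (f n)))
                        , (λ f → mod λ n _ → trans (cong (λ x → f n ℤ.+ x) (ℤ.-1*i≡-i (f n))) (ℤ.+-inverseʳ (f n)))
              ; ⁻¹-cong = λ (mod p) → mod λ n n<M → cong (-1ℤ ℤ.*_) (p n n<M) }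
            ; comm = λ f g → mod λ n _ → ℤ.+-comm (f n) (g n) }
          ; *-cong = λ {f} {f′} {g} {g′} (mod p) (mod r) → mod (*ˢ-cong-mod {M} {f} {f′} {g} {g′} p r)
          ; *-assoc = λ f g h → mod λ n _ → *ˢ-assoc f g h n
          ; *-identity = (λ f → mod λ n _ → 1•1*f f n) , (λ f → mod λ n _ → trans (*ˢ-comm f (1ℤ • 1ˢ) n) (1•1*f f n))
          ; distrib = (λ f g h → mod λ n _ → trans (*ˢ-comm f (g +ˢ h) n)
                         (trans (*ˢ-distribʳ f g h n) (cong₂ ℤ._+_ (*ˢ-comm g f n) (*ˢ-comm h f n))))
                    , (λ f g h → mod λ n _ → *ˢ-distribʳ f g h n) }
        ; *-comm = λ f g → mod λ n _ → *ˢ-comm f g n }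

  𝓡 : ℕ → CommutativeRing 0ℓ 0ℓ
  𝓡 M = record { isCommutativeRing = isCommutativeRing M }

  open module 𝓡ₘ {M : ℕ} = CommutativeRing (𝓡 M)
    using (+-cong; +-congˡ; +-congʳ; +-assoc; +-comm; +-identityˡ; +-identityʳ; -‿cong; -‿inverseʳ;
           *-cong; *-congˡ; *-congʳ; *-assoc; *-comm; *-identityˡ; *-identityʳ; zeroˡ; zeroʳ; distribˡ; distribʳ)
    renaming (setoid to ≋-setoid; refl to ≋-refl; sym to ≋-sym; trans to ≋-trans)

  module ≋-Reasoning {M : ℕ} = SetoidReasoning (≋-setoid {M})

  opaque
    unfolding _+_

    ι-+ : ∀ {M} a b → ι (a ℤ.+ b) ≋[ M ] ι a + ι b
    ι-+ a b = mod λ n _ → ℤ.*-distribʳ-+ (1ˢ n) a b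

    ι-* : ∀ {M} a b → ι (a ℤ.* b) ≋[ M ] ι a * ι b
    ι-* a b = mod λ n _ → trans (ℤ.*-assoc a b (1ˢ n))
      (sym (trans (•-*ˢ a 1ˢ (b • 1ˢ) n) (cong (a ℤ.*_) (*ˢ-identityˡ (b • 1ˢ) n))))

    ι-neg : ∀ {M} a → ι (ℤ.- a) ≋[ M ] - ι a
    ι-neg a = mod λ n _ → trans (sym (ℤ.neg-distribˡ-* a (1ˢ n))) (sym (ℤ.-1*i≡-i (a ℤ.* 1ˢ n)))

    ι-*-• : ∀ {M} c f → ι c * f ≋[ M ] c • f
    ι-*-• c f = mod λ n _ → trans (•-*ˢ c 1ˢ f n) (cong (c ℤ.*_) (*ˢ-identityˡ f n))

  ι-homomorphism : ∀ M → ℤ.+-*-rawRing -Raw-AlmostCommutative⟶ fromCommutativeRing (𝓡 M)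
  ι-homomorphism M = record
    { ⟦_⟧ = ι ; +-homo = ι-+ ; *-homo = ι-* ; -‿homo = ι-neg ; 0-homo = ≋-refl ; 1-homo = ≋-refl }

  ι-≟ : ∀ M a b → Maybe (ι a ≋[ M ] ι b)
  ι-≟ M a b with a ℤ.≟ b
  ... | yes refl = just ≋-refl
  ... | no _     = nothing

  open module Solver {M : ℕ} = RingSolver ℤ.+-*-rawRing (fromCommutativeRing (𝓡 M)) (ι-homomorphism M) (ι-≟ M)
    using (solve; _:=_; _:+_; _:*_; _:-_; :-_; con)

  -- Finite sums and products

  infixr 8 _^_

  _^_ : PowerSeries → ℕ → PowerSeries
  f ^ zero  = 1#
  f ^ suc k = f * f ^ k

  Σ< Π< : ℕ → (ℕ → PowerSeries) → PowerSeries
  Σ< zero    f = 0#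
  Σ< (suc n) f = f 0 + Σ< n (f ∘ suc)
  Π< zero    f = 1#
  Π< (suc n) f = Π< n f * f n

  opaque
    unfolding _+_

    1ˢ≋1# : ∀ {M} → 1ˢ ≋[ M ] 1#
    1ˢ≋1# = mod λ n _ → sym (ℤ.*-identityˡ (1ˢ n))

    +ˢ≋+ : ∀ {M f g} → f +ˢ g ≋[ M ] f + g
    +ˢ≋+ = mod λ _ _ → refl

    -ˢ≋- : ∀ {M f g} → f -ˢ g ≋[ M ] f - g
    -ˢ≋- {f = f} {g} = mod λ n _ → cong (λ x → f n ℤ.+ x) (sym (ℤ.-1*i≡-i (g n)))

    *ˢ≋* : ∀ {M f g} → f *ˢ g ≋[ M ] f * g
    *ˢ≋* = mod λ _ _ → refl

    *-cong-O : ∀ {j k f g} → f ≋[ j ] 0# → g ≋[ k ] 0# → f * g ≋[ j ℕ.+ k ] 0#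
    *-cong-O {f = f} {g} (mod p) (mod r) = mod (O-* {f = f} {g} p r)

    q^-* : ∀ {M} m n → q^ m * q^ n ≋[ M ] q^ (m ℕ.+ n)
    q^-* m n = mod λ i _ → q^-+ m n i

    q^-cancelˡ : ∀ {M} m {f g} → q^ m * f ≋[ m ℕ.+ M ] q^ m * g → f ≋[ M ] g
    q^-cancelˡ m {f} {g} (mod p) = mod λ n n<M →
      trans (sym (q^-*ˢ-+ m f n)) (trans (p (m ℕ.+ n) (ℕ.+-monoʳ-< m n<M)) (q^-*ˢ-+ m g n))

    coeff-q^-* : ∀ m f n → (q^ m * f) (m ℕ.+ n) ≡ f n
    coeff-q^-* = q^-*ˢ-+

    coeff-q^-*-< : ∀ m f n → n < m → (q^ m * f) n ≡ 0ℤ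
    coeff-q^-*-< m f = O-*ˡ {m} {q^ m} f (O-q^ m)

    Σ<-coeff : ∀ N f n → Σ< N f n ≡ ∑[ k < N ] f (toℕ k) n
    Σ<-coeff zero    f n = refl
    Σ<-coeff (suc N) f n = cong (λ x → f 0 n ℤ.+ x) (Σ<-coeff N (f ∘ suc) n)

    O⇒≋0 : ∀ {M f} → O[q^ M ] f → f ≋[ M ] 0#
    O⇒≋0 p = mod p

  ≡⇒≋ : ∀ {M f g} → f ≡ g → f ≋[ M ] g
  ≡⇒≋ refl = ≋-refl

  q^0≋1 : ∀ {M} → q^ 0 ≋[ M ] 1#
  q^0≋1 = 1ˢ≋1#

  weaken : ∀ {M N f g} → M ≤ N → f ≋[ N ] g → f ≋[ M ] g
  weaken M≤N (mod p) = mod λ n n<M → p n (ℕ.<-≤-trans n<M M≤N)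

  exact : ∀ {f g} → (∀ M → f ≋[ M ] g) → f ≗ g
  exact p n = unmod (p (suc n)) n ℕ.≤-refl

  q^≋0 : ∀ {M m} → M ≤ m → q^ m ≋[ M ] 0#
  q^≋0 M≤m = weaken M≤m (O⇒≋0 (O-q^ _))

  ≋⇒-≋0 : ∀ {M f g} → f ≋[ M ] g → f - g ≋[ M ] 0#
  ≋⇒-≋0 p = ≋-trans (+-congʳ p) (-‿inverseʳ _)

  -≋0⇒≋ : ∀ {M f g} → f - g ≋[ M ] 0# → f ≋[ M ] g
  -≋0⇒≋ {M} {f} {g} p = begin
    f           ≈⟨ solve 2 (λ f g → f := (f :- g) :+ g) ≋-refl f g ⟩
    (f - g) + g ≈⟨ +-congʳ p ⟩
    0# + g      ≈⟨ +-identityˡ g ⟩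
    g           ∎
    where open ≋-Reasoning

  -- The orders of h and of f - g add up, so a factor of order j gains j digits. `E-limit` lives on
  -- this gain.
  *-raise : ∀ {j k h f g} → h ≋[ j ] 0# → f ≋[ k ] g → h * f ≋[ j ℕ.+ k ] h * g
  *-raise {h = h} {f} {g} p r = -≋0⇒≋ (≋-trans
    (solve 3 (λ h f g → h :* f :- h :* g := h :* (f :- g)) ≋-refl h f g)
    (*-cong-O p (≋⇒-≋0 r)))

  ^-cong : ∀ {M f g} k → f ≋[ M ] g → f ^ k ≋[ M ] g ^ k
  ^-cong zero    p = ≋-refl
  ^-cong (suc k) p = *-cong p (^-cong k p)

  ^ˢ≋^ : ∀ {M} f k → f ^ˢ k ≋[ M ] f ^ k
  ^ˢ≋^ f zero    = 1ˢ≋1#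
  ^ˢ≋^ f (suc k) = ≋-trans *ˢ≋* (*-congˡ (^ˢ≋^ f k))

  ^-+ : ∀ {M} f m n → f ^ (m ℕ.+ n) ≋[ M ] f ^ m * f ^ n
  ^-+ f zero    n = ≋-sym (*-identityˡ _)
  ^-+ f (suc m) n = ≋-trans (*-congˡ (^-+ f m n)) (≋-sym (*-assoc f (f ^ m) (f ^ n)))

  *-^ : ∀ {M} f g n → (f * g) ^ n ≋[ M ] f ^ n * g ^ n
  *-^ f g zero    = ≋-sym (*-identityˡ _)
  *-^ f g (suc n) = ≋-trans (*-congˡ (*-^ f g n))
    (solve 4 (λ f g a b → f :* g :* (a :* b) := f :* a :* (g :* b)) ≋-refl f g (f ^ n) (g ^ n))

  ^-O : ∀ {d f} → f ≋[ d ] 0# → ∀ k → f ^ k ≋[ k ℕ.* d ] 0#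
  ^-O p zero    = mod λ _ ()
  ^-O p (suc k) = *-cong-O p (^-O p k)

  q^-^ : ∀ {M} d k → (q^ d) ^ k ≋[ M ] q^ (k ℕ.* d)
  q^-^ d zero    = ≋-sym q^0≋1
  q^-^ d (suc k) = ≋-trans (*-congˡ (q^-^ d k)) (q^-* d (k ℕ.* d))

  Σ<-cong-< : ∀ {M} n {f g} → (∀ k → k < n → f k ≋[ M ] g k) → Σ< n f ≋[ M ] Σ< n g
  Σ<-cong-< zero    p = ≋-refl
  Σ<-cong-< (suc n) p = +-cong (p 0 (s≤s z≤n)) (Σ<-cong-< n (λ k k<n → p (suc k) (s≤s k<n)))

  Σ<-cong : ∀ {M} n {f g} → (∀ k → f k ≋[ M ] g k) → Σ< n f ≋[ M ] Σ< n g
  Σ<-cong n p = Σ<-cong-< n (λ k _ → p k)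

  Σ<-zero : ∀ {M} n {f} → (∀ k → f k ≋[ M ] 0#) → Σ< n f ≋[ M ] 0#
  Σ<-zero zero    p = ≋-refl
  Σ<-zero (suc n) p = ≋-trans (+-cong (p 0) (Σ<-zero n (p ∘ suc))) (+-identityˡ 0#)

  Σ<-+ : ∀ {M} n f g → Σ< n (λ k → f k + g k) ≋[ M ] Σ< n f + Σ< n g
  Σ<-+ zero    f g = ≋-sym (+-identityˡ 0#)
  Σ<-+ (suc n) f g = ≋-trans (+-congˡ (Σ<-+ n (f ∘ suc) (g ∘ suc)))
    (solve 4 (λ a b c d → (a :+ b) :+ (c :+ d) := (a :+ c) :+ (b :+ d)) ≋-refl (f 0) (g 0) (Σ< n (f ∘ suc))
        (Σ< n (g ∘ suc)))

  Σ<-*ˡ : ∀ {M} n h f → Σ< n (λ k → h * f k) ≋[ M ] h * Σ< n f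
  Σ<-*ˡ zero    h f = ≋-sym (zeroʳ h)
  Σ<-*ˡ (suc n) h f = ≋-trans (+-congˡ (Σ<-*ˡ n h (f ∘ suc))) (≋-sym (distribˡ h (f 0) _))

  Σ<-split : ∀ {M} m n f → Σ< (m ℕ.+ n) f ≋[ M ] Σ< m f + Σ< n (λ k → f (m ℕ.+ k))
  Σ<-split zero    n f = ≋-sym (+-identityˡ _)
  Σ<-split (suc m) n f = ≋-trans (+-congˡ (Σ<-split m n (f ∘ suc))) (≋-sym (+-assoc _ _ _))

  Σ<-last : ∀ {M} n f → Σ< (suc n) f ≋[ M ] Σ< n f + f n
  Σ<-last zero    f = +-comm _ _
  Σ<-last (suc n) f = ≋-trans (+-congˡ (Σ<-last n (f ∘ suc))) (≋-sym (+-assoc _ _ _))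

  Σ<-tail : ∀ {M m n f} → m ≤ n → (∀ k → m ≤ k → f k ≋[ M ] 0#) → Σ< n f ≋[ M ] Σ< m f
  Σ<-tail {M} {m} {n} {f} m≤n p = begin
    Σ< n f                                           ≡⟨ cong (λ n → Σ< n f) (ℕ.m+[n∸m]≡n m≤n) ⟨
    Σ< (m ℕ.+ (n ∸ m)) f                             ≈⟨ Σ<-split m (n ∸ m) f ⟩
    Σ< m f + Σ< (n ∸ m) (λ k → f (m ℕ.+ k))          ≈⟨ +-congˡ (Σ<-zero (n ∸ m) (λ k → p (m ℕ.+ k) (ℕ.m≤m+n m k))) ⟩
    Σ< m f + 0#                                      ≈⟨ +-identityʳ _ ⟩
    Σ< m f                                           ∎
    where open ≋-Reasoning

  Σ<-drop : ∀ {M m n f} → m ≤ n → (∀ k → k < m → f k ≋[ M ] 0#) → Σ< n f ≋[ M ] Σ< (n ∸ m) (λ k → f (m ℕ.+ k))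
  Σ<-drop {M} {m} {n} {f} m≤n p = begin
    Σ< n f                                           ≡⟨ cong (λ n → Σ< n f) (ℕ.m+[n∸m]≡n m≤n) ⟨
    Σ< (m ℕ.+ (n ∸ m)) f                             ≈⟨ Σ<-split m (n ∸ m) f ⟩
    Σ< m f + Σ< (n ∸ m) (λ k → f (m ℕ.+ k))          ≈⟨ +-congʳ (≋-trans (Σ<-cong-< m p) (Σ<-zero m (λ _ → ≋-refl))) ⟩
    0# + Σ< (n ∸ m) (λ k → f (m ℕ.+ k))              ≈⟨ +-identityˡ _ ⟩
    Σ< (n ∸ m) (λ k → f (m ℕ.+ k))                   ∎
    where open ≋-Reasoning

  ∑^∞-truncate : ∀ {M N} f (hf : ∀ k → O[q^ k ] (f k)) → M ≤ N → ∑^∞ f hf ≋[ M ] Σ< N f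
  ∑^∞-truncate {M} {N} f hf M≤N = mod λ n n<M → trans (sym (Σ<-coeff (suc n) f n))
    (sym (unmod (Σ<-tail {m = suc n} {N} {f} (ℕ.≤-trans n<M M≤N) (λ k n<k → weaken n<k (O⇒≋0 (hf k)))) n ℕ.≤-refl))

  Π<-cong : ∀ {M} n {f g} → (∀ k → f k ≋[ M ] g k) → Π< n f ≋[ M ] Π< n g
  Π<-cong zero    p = ≋-refl
  Π<-cong (suc n) p = *-cong (Π<-cong n p) (p n)

  Π<-* : ∀ {M} n f g → Π< n (λ k → f k * g k) ≋[ M ] Π< n f * Π< n g
  Π<-* zero    f g = ≋-sym (*-identityˡ 1#)
  Π<-* (suc n) f g = ≋-trans (*-congʳ (Π<-* n f g))
    (solve 4 (λ a b c d → a :* b :* (c :* d) := a :* c :* (b :* d)) ≋-refl (Π< n f) (Π< n g) (f n) (g n))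

  Π<-one : ∀ {M} n f → (∀ k → f k ≋[ M ] 1#) → Π< n f ≋[ M ] 1#
  Π<-one zero    f p = ≋-refl
  Π<-one (suc n) f p = ≋-trans (*-cong (Π<-one n f p) (p n)) (*-identityˡ 1#)

  Π<-tail : ∀ {M m n f} → m ≤ n → (∀ k → m ≤ k → f k ≋[ M ] 1#) → Π< n f ≋[ M ] Π< m f
  Π<-tail {M} {m} {n} {f} m≤n p with ℕ.m≤n⇒m<n∨m≡n m≤n
  ... | inj₂ refl = ≋-refl
  Π<-tail {M} {m} {suc n} {f} m≤n p | inj₁ (s≤s m≤n′) =
    ≋-trans (*-cong (Π<-tail m≤n′ p) (p n m≤n′)) (*-identityʳ _)

  ∏^<≋Π< : ∀ {M} n f → ∏^< n f ≋[ M ] Π< n f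
  ∏^<≋Π< zero    f = 1ˢ≋1#
  ∏^<≋Π< (suc n) f = ≋-trans *ˢ≋* (*-congʳ (∏^<≋Π< n f))

  ∏^∞-truncate : ∀ {M N} f (hf : ∀ k → f k ≡ 1ˢ [mod-q^ k ]) → M ≤ N → ∏^∞ f hf ≋[ M ] Π< N f
  ∏^∞-truncate {M} {N} f hf M≤N = mod λ n n<M → trans (unmod (∏^<≋Π< (suc n) f) n ℕ.≤-refl)
    (sym (unmod (Π<-tail {m = suc n} {N} {f} (ℕ.≤-trans n<M M≤N)
      (λ k n<k → weaken n<k (≋-trans (mod (hf k)) 1ˢ≋1#))) n ℕ.≤-refl))

  -- Reciprocals and cancellation

  geometric : ∀ {M} x n → (1# - x) * Σ< n (x ^_) ≋[ M ] 1# - x ^ n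
  geometric x zero = solve 1 (λ x → (con 1ℤ :- x) :* con 0ℤ := con 1ℤ :- con 1ℤ) ≋-refl x
  geometric x (suc n) = begin
    (1# - x) * Σ< (suc n) (x ^_)                    ≈⟨ *-congˡ (Σ<-last n (x ^_)) ⟩
    (1# - x) * (Σ< n (x ^_) + x ^ n)                ≈⟨ distribˡ _ _ _ ⟩
    (1# - x) * Σ< n (x ^_) + (1# - x) * x ^ n       ≈⟨ +-congʳ (geometric x n) ⟩
    1# - x ^ n + (1# - x) * x ^ n
      ≈⟨ solve 2 (λ x y → con 1ℤ :- y :+ (con 1ℤ :- x) :* y := con 1ℤ :- x :* y) ≋-refl x (x ^ n) ⟩
    1# - x * x ^ n                                  ∎
    where open ≋-Reasoning

  -- With y = 1 - f, the series is cut to ∑_{k<M} y^k, and (1 - y) ∑_{k<M} y^k = 1 - y^M, where y^M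
  -- has order at least M.
  recip-inverse : ∀ {M} f (f0≡1 : f 0 ≡ 1ℤ) → f * recip f f0≡1 ≋[ M ] 1#
  recip-inverse {M} f f0≡1 = begin
    f * recip f f0≡1
      ≈⟨ *-congˡ (∑^∞-truncate ((1ˢ -ˢ f) ^ˢ_) (O-^ (O-1-f f0≡1)) ℕ.≤-refl) ⟩
    f * Σ< M ((1ˢ -ˢ f) ^ˢ_)
      ≈⟨ *-cong (solve 1 (λ f → f := con 1ℤ :- (con 1ℤ :- f)) ≋-refl f)
                (Σ<-cong M (λ k → ≋-trans (^ˢ≋^ _ k) (^-cong k (≋-trans -ˢ≋- (+-congʳ 1ˢ≋1#))))) ⟩
    (1# - (1# - f)) * Σ< M ((1# - f) ^_)
      ≈⟨ geometric (1# - f) M ⟩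
    1# - (1# - f) ^ M
      ≈⟨ +-congˡ (-‿cong (weaken (ℕ.≤-reflexive (sym (ℕ.*-identityʳ M)))
           (^-O (≋-trans (≋-sym (≋-trans -ˢ≋- (+-congʳ 1ˢ≋1#))) (O⇒≋0 (O-1-f f0≡1))) M))) ⟩
    1# - 0#
      ≈⟨ solve 0 (con 1ℤ :- con 0ℤ := con 1ℤ) ≋-refl ⟩
    1# ∎
    where open ≋-Reasoning

  -- A series with constant term 1 is invertible; in contrast to `q^-cancelˡ`, no precision is lost.
  *-cancelˡ-unit : ∀ {M f g h} → f ≋[ 1 ] 1# → f * g ≋[ M ] f * h → g ≋[ M ] h
  *-cancelˡ-unit {M} {f} {g} {h} f≋1 p = begin
    g               ≈⟨ inverse g ⟨
    r * (f * g)     ≈⟨ *-congˡ p ⟩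
    r * (f * h)     ≈⟨ inverse h ⟩
    h               ∎
    where
    open ≋-Reasoning
    f0≡1 : f 0 ≡ 1ℤ
    f0≡1 = unmod (≋-trans f≋1 (≋-sym 1ˢ≋1#)) 0 (s≤s z≤n)
    r = recip f f0≡1
    inverse : ∀ x → r * (f * x) ≋[ M ] x
    inverse x = begin
      r * (f * x) ≈⟨ solve 3 (λ r f x → r :* (f :* x) := f :* r :* x) ≋-refl r f x ⟩
      f * r * x   ≈⟨ *-congʳ (recip-inverse f f0≡1) ⟩
      1# * x      ≈⟨ *-identityˡ x ⟩
      x           ∎

  -- The sum over the integers β with -K ≤ β < K.
  opaque
    Σ± : ℕ → (ℤ → PowerSeries) → PowerSeries
    Σ± K f = Σ< K (f ∘ +_) + Σ< K (f ∘ -[1+_])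

  opaque
    unfolding Σ±

    Σ±-cong-< : ∀ {M} K {f g} → (∀ k → k < K → f (+ k) ≋[ M ] g (+ k)) →
                (∀ k → k < K → f -[1+ k ] ≋[ M ] g -[1+ k ]) → Σ± K f ≋[ M ] Σ± K g
    Σ±-cong-< K p r = +-cong (Σ<-cong-< K p) (Σ<-cong-< K r)

    Σ±-cong : ∀ {M} K {f g} → (∀ β → f β ≋[ M ] g β) → Σ± K f ≋[ M ] Σ± K g
    Σ±-cong K {f} {g} p = Σ±-cong-< K {f} {g} (λ k _ → p (+ k)) (λ k _ → p -[1+ k ])

    Σ±-+ : ∀ {M} K f g → Σ± K (λ β → f β + g β) ≋[ M ] Σ± K f + Σ± K g
    Σ±-+ K f g = ≋-trans (+-cong (Σ<-+ K (f ∘ +_) (g ∘ +_)) (Σ<-+ K (f ∘ -[1+_]) (g ∘ -[1+_])))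
      (solve 4 (λ a b c d → (a :+ b) :+ (c :+ d) := (a :+ c) :+ (b :+ d)) ≋-refl
        (Σ< K (f ∘ +_)) (Σ< K (g ∘ +_)) (Σ< K (f ∘ -[1+_])) (Σ< K (g ∘ -[1+_])))

    Σ±-*ˡ : ∀ {M} K h f → Σ± K (λ β → h * f β) ≋[ M ] h * Σ± K f
    Σ±-*ˡ K h f = ≋-trans (+-cong (Σ<-*ˡ K h (f ∘ +_)) (Σ<-*ˡ K h (f ∘ -[1+_]))) (≋-sym (distribˡ h _ _))

    -- The shift moves the window from [-K-1, K] to [-K, K+1], so the two sums differ only by the
    -- two end terms assumed to vanish.
    Σ±-suc : ∀ {M K f} → f -[1+ K ] ≋[ M ] 0# → f (+ suc K) ≋[ M ] 0# → Σ± (suc K) (f ∘ ℤ.suc) ≋[ M ] Σ± (suc K) f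
    Σ±-suc {M} {K} {f} p r = begin
      Σ< (suc K) (f ∘ +_ ∘ suc) + (f (+ 0) + Σ< K (f ∘ -[1+_]))
        ≈⟨ +-congʳ (≋-trans (Σ<-last K _) (≋-trans (+-congˡ r) (+-identityʳ _))) ⟩
      Σ< K (f ∘ +_ ∘ suc) + (f (+ 0) + Σ< K (f ∘ -[1+_]))
        ≈⟨ solve 3 (λ a b c → a :+ (b :+ c) := b :+ a :+ c) ≋-refl (Σ< K (f ∘ +_ ∘ suc)) (f (+ 0)) (Σ< K (f ∘ -[1+_])) ⟩
      Σ< (suc K) (f ∘ +_) + Σ< K (f ∘ -[1+_])
        ≈⟨ +-congˡ (≋-trans (Σ<-last K _) (≋-trans (+-congˡ p) (+-identityʳ _))) ⟨
      Σ± (suc K) f ∎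
      where open ≋-Reasoning

  -- Unit steps, each exchanging one end term for another. The bound on c keeps every term so
  -- exchanged at a distance of at least s from 0.
  Σ±-translate : ∀ {M K s f} → (∀ β → s ≤ ∣ β ∣ → f β ≋[ M ] 0#) → ∀ c → ∣ c ∣ ℕ.+ s ≤ K →
                 Σ± (suc K) (λ β → f (c ℤ.+ β)) ≋[ M ] Σ± (suc K) f
  Σ±-translate {M} {K} {s} {f} p = go
    where
    step : ∀ c → ∣ c ∣ ℕ.+ s ≤ K → Σ± (suc K) (λ β → f (ℤ.suc c ℤ.+ β)) ≋[ M ] Σ± (suc K) (λ β → f (c ℤ.+ β))
    step c c≤K = ≋-trans
      (Σ±-cong (suc K) (λ β → ≡⇒≋ (cong f (suc-+ c β))))
      (Σ±-suc {f = λ β → f (c ℤ.+ β)} (p _ (≤∣+∣ c -[1+ K ] (ℕ.m≤n⇒m≤1+n c≤K)))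
          (p _ (≤∣+∣ c (+ suc K) (ℕ.m≤n⇒m≤1+n c≤K))))
    go : ∀ c → ∣ c ∣ ℕ.+ s ≤ K → Σ± (suc K) (λ β → f (c ℤ.+ β)) ≋[ M ] Σ± (suc K) f
    go (+ zero)     _   = Σ±-cong (suc K) (λ β → ≡⇒≋ (cong f (ℤ.+-identityˡ β)))
    go (+ suc j)    c≤K = ≋-trans (step (+ j) (ℕ.<⇒≤ c≤K)) (go (+ j) (ℕ.<⇒≤ c≤K))
    go -[1+ zero ]  c≤K = ≋-trans (≋-sym (step -[1+ 0 ] c≤K)) (go (+ 0) (ℕ.<⇒≤ c≤K))
    go -[1+ suc j ] c≤K = ≋-trans (≋-sym (step -[1+ suc j ] c≤K)) (go -[1+ j ] (ℕ.<⇒≤ c≤K))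

  -- The Jacobi triple product

  module JacobiTriple (p : PowerSeries) where

    poch : ℕ → PowerSeries
    poch J = Π< J (λ j → 1# - p * p ^ j)

    δ : ℤ → PowerSeries
    δ (+ zero)  = 1#
    δ (+ suc _) = 0#
    δ -[1+ _ ]  = 0#

    -- E n m α is the coefficient of z^α in ∏_{i<n} (1 + z p^i) ∏_{i<m} (1 + z⁻¹ p^(i+1)).
    E : ℕ → ℕ → ℤ → PowerSeries
    E zero    zero    α = δ α
    E zero    (suc m) α = E zero m α + p ^ suc m * E zero m (ℤ.suc α)
    E (suc n) m       α = E n m α + p ^ n * E n m (ℤ.pred α)

    0+h*0 : ∀ {M f g} h → f ≋[ M ] 0# → g ≋[ M ] 0# → f + h * g ≋[ M ] 0#
    0+h*0 h f≋0 g≋0 = ≋-trans (+-cong f≋0 (≋-trans (*-congˡ g≋0) (zeroʳ h))) (+-identityˡ 0#)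

    E-zero⁻ : ∀ {M} n m i → E n m -[1+ m ℕ.+ i ] ≋[ M ] 0#
    E-zero⁻ zero    zero    i = ≋-refl
    E-zero⁻ zero    (suc m) i = 0+h*0 (p ^ suc m)
      (≋-trans (≡⇒≋ (cong (λ x → E zero m -[1+ x ]) (sym (ℕ.+-suc m i)))) (E-zero⁻ zero m (suc i)))
      (E-zero⁻ zero m i)
    E-zero⁻ (suc n) m       i = 0+h*0 (p ^ n) (E-zero⁻ n m i)
      (≋-trans (≡⇒≋ (cong (λ x → E n m -[1+ x ]) (sym (ℕ.+-suc m i)))) (E-zero⁻ n m (suc i)))

    E-zero⁺ : ∀ {M} n m i → E n m (+ suc (n ℕ.+ i)) ≋[ M ] 0#
    E-zero⁺ zero    zero    i = ≋-refl
    E-zero⁺ zero    (suc m) i = 0+h*0 (p ^ suc m) (E-zero⁺ zero m i) (E-zero⁺ zero m (suc i))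
    E-zero⁺ (suc n) m       i = 0+h*0 (p ^ n)
      (≋-trans (≡⇒≋ (cong (λ x → E n m (+ suc x)) (sym (ℕ.+-suc n i)))) (E-zero⁺ n m (suc i)))
      (E-zero⁺ n m i)

    -- The definition adds factors in z⁻¹ only while n = 0. For other n the new factor is commuted
    -- past the factors in z.
    E-suc-m : ∀ {M} n m α → E n (suc m) α ≋[ M ] E n m α + p ^ suc m * E n m (ℤ.suc α)
    E-suc-m zero    m α = ≋-refl
    E-suc-m (suc n) m α = begin
      E n (suc m) α + p ^ n * E n (suc m) (ℤ.pred α)
        ≈⟨ +-cong (E-suc-m n m α) (*-congˡ (≋-trans (E-suc-m n m (ℤ.pred α))
             (+-congˡ (*-congˡ (≡⇒≋ (cong (E n m) (trans (ℤ.suc-pred α) (sym (ℤ.pred-suc α))))))))) ⟩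
      (E n m α + p ^ suc m * E n m (ℤ.suc α)) + p ^ n * (E n m (ℤ.pred α) + p ^ suc m * E n m (ℤ.pred (ℤ.suc α)))
        ≈⟨ solve 6 (λ a b c d x y → (a :+ x :* b) :+ y :* (c :+ x :* d) := (a :+ y :* c) :+ x :* (b :+ y :* d)) ≋-refl
             (E n m α) (E n m (ℤ.suc α)) (E n m (ℤ.pred α)) (E n m (ℤ.pred (ℤ.suc α))) (p ^ suc m) (p ^ n) ⟩
      E (suc n) m α + p ^ suc m * E (suc n) m (ℤ.suc α) ∎
      where open ≋-Reasoning

    private
      -- Passing from (p;p)_{J-1} to (p;p)_J multiplies by 1 - p^J. At J = 0 this factor is 0 and
      -- `f` lies outside the support, so the boundary of the q-Pascal rule needs no separate
      -- statement.
      stepJ : ∀ {M f h P} J K → (J ≡ 0 → f ≋[ M ] 0#) →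
              (∀ J′ → J ≡ suc J′ → f * (poch J′ * poch K) ≋[ M ] h * P) →
              f * (poch J * poch K) ≋[ M ] h * (P * (1# - p ^ J))
      stepJ {f = f} {h} {P} zero K f≋0 _ = ≋-trans (*-congʳ (f≋0 refl))
        (solve 3 (λ x h P → con 0ℤ :* x := h :* (P :* (con 1ℤ :- con 1ℤ))) ≋-refl (1# * poch K) h P)
      stepJ {f = f} {h} {P} (suc J) K _ closed = begin
        f * (poch J * (1# - p * p ^ J) * poch K)
          ≈⟨ solve 4 (λ f a b c → f :* (a :* b :* c) := f :* (a :* c) :* b) ≋-refl f (poch J) (1# - p * p ^ J)
              (poch K) ⟩
        f * (poch J * poch K) * (1# - p * p ^ J)
          ≈⟨ *-congʳ (closed J refl) ⟩
        h * P * (1# - p * p ^ J)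
          ≈⟨ *-assoc h P _ ⟩
        h * (P * (1# - p * p ^ J)) ∎
        where open ≋-Reasoning

      stepK : ∀ {M f h P} J K → (K ≡ 0 → f ≋[ M ] 0#) →
              (∀ K′ → K ≡ suc K′ → f * (poch J * poch K′) ≋[ M ] h * P) →
              f * (poch J * poch K) ≋[ M ] h * (P * (1# - p ^ K))
      stepK J K f≋0 closed = ≋-trans (*-congˡ (*-comm _ _))
        (stepJ K J f≋0 (λ K′ eq → ≋-trans (*-congˡ (*-comm _ _)) (closed K′ eq)))

      scale : ∀ {M x f a b h r y P} → x * h ≋[ M ] r * y → f * (a * b) ≋[ M ] h * P →
              x * f * (a * b) ≋[ M ] r * (y * P)
      scale {x = x} {f} {a} {b} {h} {r} {y} {P} xh≋ry e = begin
        x * f * (a * b)   ≈⟨ *-assoc x f _ ⟩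
        x * (f * (a * b)) ≈⟨ *-congˡ e ⟩
        x * (h * P)       ≈⟨ *-assoc x h P ⟨
        x * h * P         ≈⟨ *-congʳ xh≋ry ⟩
        r * y * P         ≈⟨ *-assoc r y P ⟩
        r * (y * P)       ∎
        where open ≋-Reasoning

      -- The q-Pascal rule with denominators cleared: (1 - x) + x (1 - y) = 1 - x y, for x and y the
      -- powers p^J and p^K in either order.
      combine : ∀ {M f g c h P x y} N → f * c ≋[ M ] h * (P * (1# - x)) → g * c ≋[ M ] h * (x * (P * (1# - y))) →
                x * y ≋[ M ] p ^ suc N → (f + g) * c ≋[ M ] h * (P * (1# - p * p ^ N))
      combine {f = f} {g} {c} {h} {P} {x} {y} N e₁ e₂ xy = begin
        (f + g) * c                                       ≈⟨ distribʳ c f g ⟩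
        f * c + g * c                                     ≈⟨ +-cong e₁ e₂ ⟩
        h * (P * (1# - x)) + h * (x * (P * (1# - y)))
          ≈⟨ solve 4 (λ h P x y → h :* (P :* (con 1ℤ :- x)) :+ h :* (x :* (P :* (con 1ℤ :- y))) := h :*
              (P :* (con 1ℤ :- x :* y))) ≋-refl h P x y ⟩
        h * (P * (1# - x * y))                            ≈⟨ *-congˡ (*-congˡ (+-congˡ (-‿cong xy))) ⟩
        h * (P * (1# - p * p ^ N))                        ∎
        where open ≋-Reasoning

      p^-exchange : ∀ {M a b c d} → a ℕ.+ b ≡ c ℕ.+ d → p ^ a * p ^ b ≋[ M ] p ^ c * p ^ d
      p^-exchange {a = a} {b} {c} {d} eq = ≋-trans (≋-sym (^-+ p a b)) (≋-trans (≡⇒≋ (cong (p ^_) eq)) (^-+ p c d))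

      p^-join : ∀ {M a b c} → a ℕ.+ b ≡ c → p ^ a * p ^ b ≋[ M ] p ^ c
      p^-join {a = a} {b} eq = ≋-trans (≋-sym (^-+ p a b)) (≡⇒≋ (cong (p ^_) eq))

    -- The coefficient is p^T(J-m) times the Gaussian binomial (p;p)_{n+m} / ((p;p)_J (p;p)_K),
    -- multiplied out to avoid division. Removing a factor in z⁻¹ is one of the two q-Pascal rules,
    -- with weight p^J; removing a factor in z is the other, with weight p^K.
    E-closed : ∀ {M} n m J K → J ℕ.+ K ≡ n ℕ.+ m →
               E n m (J ℤ.⊖ m) * (poch J * poch K) ≋[ M ] p ^ T (J ℤ.⊖ m) * poch (n ℕ.+ m)
    E-closed zero zero zero zero _ = solve 0 (con 1ℤ :* (con 1ℤ :* con 1ℤ) := con 1ℤ :* con 1ℤ) ≋-refl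
    E-closed zero (suc m) J K J+K≡1+m = combine m
      (stepJ {f = E zero m (J ℤ.⊖ suc m)} J K
        (λ where refl → ≋-trans (≡⇒≋ (cong (λ x → E zero m -[1+ x ]) (sym (ℕ.+-identityʳ m)))) (E-zero⁻ zero m 0))
        λ where J′ refl → ≋-trans (*-congʳ (≡⇒≋ (cong (E zero m) (ℤ.[1+m]⊖[1+n]≡m⊖n J′ m))))
                  (≋-trans (E-closed zero m J′ K (ℕ.suc-injective J+K≡1+m))
                    (*-congʳ (≡⇒≋ (cong (λ α → p ^ T α) (sym (ℤ.[1+m]⊖[1+n]≡m⊖n J′ m)))))))
      (scale {h = p ^ T (ℤ.suc (J ℤ.⊖ suc m))} (p^-exchange {a = suc m} {c = T (J ℤ.⊖ suc m)} {J} (m+T[suc] (suc m) J))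
        (stepK {f = E zero m (ℤ.suc (J ℤ.⊖ suc m))} J K
          (λ where refl → ≋-trans (≡⇒≋ (cong (E zero m) (trans (suc-⊖-suc J m)
                            (trans (cong (ℤ._⊖ m) (trans (sym (ℕ.+-identityʳ J)) J+K≡1+m))
                                (trans (ℤ.≤-⊖ (ℕ.n≤1+n m)) (cong +_ (ℕ.m+n∸n≡m 1 m)))))))
                          (E-zero⁺ zero m 0))
          λ where K′ refl → ≋-trans (*-congʳ (≡⇒≋ (cong (E zero m) (suc-⊖-suc J m))))
                    (≋-trans (E-closed zero m J K′ (ℕ.suc-injective (trans (sym (ℕ.+-suc J K′)) J+K≡1+m)))
                      (*-congʳ (≡⇒≋ (cong (λ α → p ^ T α) (sym (suc-⊖-suc J m))))))))
      (p^-join {a = J} J+K≡1+m)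
    E-closed (suc n) m J K J+K≡1+n+m = combine (n ℕ.+ m)
      (stepK {f = E n m (J ℤ.⊖ m)} J K
        (λ where refl → ≋-trans (≡⇒≋ (cong (E n m) (trans (cong (ℤ._⊖ m) (trans (sym (ℕ.+-identityʳ J)) J+K≡1+n+m))
                            (trans (ℤ.≤-⊖ (ℕ.m≤n+m m (suc n)))
                                (cong +_ (trans (ℕ.m+n∸n≡m (suc n) m) (cong suc (sym (ℕ.+-identityʳ n)))))))))
                          (E-zero⁺ n m 0))
        λ where K′ refl → E-closed n m J K′ (ℕ.suc-injective (trans (sym (ℕ.+-suc J K′)) J+K≡1+n+m)))
      (scale {h = p ^ T (ℤ.pred (J ℤ.⊖ m))} (p^-exchange {a = n} {c = T (J ℤ.⊖ m)} {K} (n+T[pred] n m J K J+K≡1+n+m))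
        (stepJ {f = E n m (ℤ.pred (J ℤ.⊖ m))} J K
          (λ where refl → ≋-trans (≡⇒≋ (cong (E n m) (trans (pred-0⊖ m) (cong -[1+_] (sym (ℕ.+-identityʳ m)))))) (E-zero⁻ n m 0))
          λ where J′ refl → ≋-trans (*-congʳ (≡⇒≋ (cong (E n m) (pred-suc-⊖ J′ m))))
                    (≋-trans (E-closed n m J′ K (ℕ.suc-injective J+K≡1+n+m))
                      (*-congʳ (≡⇒≋ (cong (λ α → p ^ T α) (sym (pred-suc-⊖ J′ m))))))))
      (p^-join {a = K} (trans (ℕ.+-comm K J) J+K≡1+n+m))

  module JacobiTripleLimit (p : PowerSeries) {d} (p≋0 : p ≋[ d ] 0#) (1≤d : 1 ≤ d) where
    open JacobiTriple p public

    p^≋0 : ∀ {M} k → M ≤ k → p ^ k ≋[ M ℕ.* d ] 0#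
    p^≋0 k M≤k = weaken (ℕ.*-monoˡ-≤ d M≤k) (^-O p≋0 k)

    poch-tail : ∀ {J X} → J ≤ X → poch X ≋[ suc J ℕ.* d ] poch J
    poch-tail {J} J≤X = Π<-tail J≤X λ j J≤j → begin
      1# - p * p ^ j ≈⟨ +-congˡ (-‿cong (p^≋0 (suc j) (s≤s J≤j))) ⟩
      1# - 0#        ≈⟨ solve 0 (con 1ℤ :- con 0ℤ := con 1ℤ) ≋-refl ⟩
      1#             ∎
      where open ≋-Reasoning

    poch≋1 : ∀ J → poch J ≋[ 1 ] 1#
    poch≋1 J = weaken 1≤d (weaken (ℕ.≤-reflexive (sym (ℕ.+-identityʳ d))) (poch-tail {0} {J} z≤n))

    *-poch-tail : ∀ {M J X} t → J ≤ X → M ≤ t ℕ.+ suc J → p ^ t * poch X ≋[ M ℕ.* d ] p ^ t * poch J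
    *-poch-tail {M} {J} t J≤X M≤ = weaken
      (ℕ.≤-trans (ℕ.*-monoˡ-≤ d M≤) (ℕ.≤-reflexive (ℕ.*-distribʳ-+ d t (suc J))))
      (*-raise (^-O p≋0 t) (poch-tail J≤X))

    -- By `E-closed` the claim reduces to replacing `poch (n + m)` by `poch J` and `poch X` by
    -- `poch K`. Each replacement is poor when J or K is small, but p^T(α) stands in front and T α
    -- is large exactly there. Outside the support the left side is 0 and T α alone exceeds the
    -- precision.
    E-limit : ∀ {M n m X} → n ℕ.+ m ≤ X → M ≤ n → M ≤ m → ∀ α → E n m α * poch X ≋[ M ℕ.* d ] p ^ T α
    E-limit {M} {n} {m} {X} n+m≤X M≤n M≤m α with position n m α
    ... | below i = ≋-trans (≋-trans (*-congʳ (E-zero⁻ n m i)) (zeroˡ _))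
      (≋-sym (p^≋0 (T -[1+ m ℕ.+ i ]) (ℕ.≤-trans M≤m (ℕ.≤-trans (ℕ.m≤m+n m i) (ℕ.≤-pred (∣α∣≤1+T -[1+ m ℕ.+ i ]))))))
    ... | above i = ≋-trans (≋-trans (*-congʳ (E-zero⁺ n m i)) (zeroˡ _))
      (≋-sym (p^≋0 (T (+ suc (n ℕ.+ i)))
          (ℕ.≤-trans M≤n (ℕ.≤-trans (ℕ.m≤m+n n i) (ℕ.≤-pred (∣α∣≤1+T (+ suc (n ℕ.+ i))))))))
    ... | within J K J+K≡n+m = *-cancelˡ-unit
      (≋-trans (*-cong (poch≋1 J) (poch≋1 K)) (*-identityˡ 1#)) (begin
        poch J * poch K * (G * poch X)
          ≈⟨ solve 4 (λ a b g x → a :* b :* (g :* x) := g :* (a :* b) :* x) ≋-refl (poch J) (poch K) G (poch X) ⟩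
        G * (poch J * poch K) * poch X
          ≈⟨ *-congʳ (E-closed n m J K J+K≡n+m) ⟩
        p ^ t * poch (n ℕ.+ m) * poch X
          ≈⟨ *-congʳ (*-poch-tail t (ℕ.≤-trans (ℕ.m≤m+n J K) (ℕ.≤-reflexive J+K≡n+m)) (ℕ.≤-trans M≤m (m≤1+T+J m J))) ⟩
        p ^ t * poch J * poch X
          ≈⟨ solve 3 (λ h a x → h :* a :* x := a :* (h :* x)) ≋-refl (p ^ t) (poch J) (poch X) ⟩
        poch J * (p ^ t * poch X)
          ≈⟨ *-congˡ (*-poch-tail t (ℕ.≤-trans (ℕ.m≤n+m K J) (ℕ.≤-trans (ℕ.≤-reflexive J+K≡n+m) n+m≤X))
               (ℕ.≤-trans M≤n (n≤1+T+K n m J K J+K≡n+m))) ⟩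
        poch J * (p ^ t * poch K)
          ≈⟨ solve 3 (λ h a b → a :* (h :* b) := a :* b :* h) ≋-refl (p ^ t) (poch J) (poch K) ⟩
        poch J * poch K * p ^ t ∎)
      where
      open ≋-Reasoning
      G = E n m (J ℤ.⊖ m)
      t = T (J ℤ.⊖ m)

  -- Evaluation of the finite triple product at z = a, with z⁻¹p evaluated to b.  The weight
  -- w α stands for a^(K + α), which makes sense although a need not be invertible.
  module Evaluation {p a b : PowerSeries} (a*b≋p : ∀ {M} → a * b ≋[ M ] p) (K′ : ℕ) where
    open JacobiTriple p

    private K = suc K′

    w : ℤ → PowerSeries
    w (+ k)    = a ^ (K ℕ.+ k)
    w -[1+ k ] = a ^ (K′ ∸ k)

    w-suc⁺ : ∀ {M} k → w (ℤ.suc (+ k)) ≋[ M ] a * w (+ k)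
    w-suc⁺ k = ≡⇒≋ (cong (a ^_) (ℕ.+-suc K k))

    w-suc⁻ : ∀ {M} k → k < K → w (ℤ.suc -[1+ k ]) ≋[ M ] a * w -[1+ k ]
    w-suc⁻ zero    _         = ≡⇒≋ (cong (a ^_) (ℕ.+-identityʳ K))
    w-suc⁻ (suc k) (s≤s k<K′) = ≡⇒≋ (cong (a ^_) (m∸n≡1+[m∸1+n] k<K′))
      where
      m∸n≡1+[m∸1+n] : ∀ {m n} → n < m → m ∸ n ≡ suc (m ∸ suc n)
      m∸n≡1+[m∸1+n] {suc m} {zero}  _         = refl
      m∸n≡1+[m∸1+n] {suc m} {suc n} (s≤s n<m) = m∸n≡1+[m∸1+n] n<m

    -- For a coefficient sequence v supported in the window, this is a^K times the value of ∑ v_α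
    -- z^α at z = a.
    L : (ℤ → PowerSeries) → PowerSeries
    L v = Σ± K (λ α → w α * v α)

    L-+-* : ∀ {M} x u v → L (λ α → u α + x * v α) ≋[ M ] L u + x * L v
    L-+-* x u v = ≋-trans
      (Σ±-cong K (λ α → solve 4 (λ w u x v → w :* (u :+ x :* v) := w :* u :+ x :* (w :* v)) ≋-refl (w α) (u α) x (v α)))
      (≋-trans (Σ±-+ K _ _) (+-congˡ (Σ±-*ˡ K x _)))

    a*L : ∀ {M} v → a * L v ≋[ M ] Σ± K (λ α → w (ℤ.suc α) * v α)
    a*L v = ≋-trans (≋-sym (Σ±-*ˡ K a _)) (Σ±-cong-< K
      (λ k _   → ≋-trans (≋-sym (*-assoc a _ _)) (*-congʳ (≋-sym (w-suc⁺ k))))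
      (λ k k<K → ≋-trans (≋-sym (*-assoc a _ _)) (*-congʳ (≋-sym (w-suc⁻ k k<K)))))

    E-zero⁻′ : ∀ {M} n {m} → m ≤ K′ → E n m -[1+ K′ ] ≋[ M ] 0#
    E-zero⁻′ {M} n {m} m≤K′ = subst (λ k → E n m -[1+ k ] ≋[ M ] 0#) (ℕ.m+[n∸m]≡n m≤K′) (E-zero⁻ n m (K′ ∸ m))

    E-zero⁺′ : ∀ {M n} m {k} → n < k → E n m (+ k) ≋[ M ] 0#
    E-zero⁺′ {M} {n} m {k} n<k = subst (λ k → E n m (+ k) ≋[ M ] 0#) (ℕ.m+[n∸m]≡n n<k) (E-zero⁺ n m (k ∸ suc n))

    w*0 : ∀ {M v} x → v ≋[ M ] 0# → x * v ≋[ M ] 0#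
    w*0 x v≋0 = ≋-trans (*-congˡ v≋0) (zeroʳ x)

    -- Under `L`, multiplying by z becomes multiplying by a. For a factor in z⁻¹ one p of p^(m+1) is
    -- written as a b: the a undoes the shift and b p^m remains. The bounds on n and m make the
    -- coefficients vanish where a shift crosses the ends of the window.
    L-E : ∀ {M} n m → n ≤ K′ → m ≤ K′ →
          L (E n m) ≋[ M ] a ^ K * (Π< m (λ i → 1# + b * p ^ i) * Π< n (λ i → 1# + a * p ^ i))
    L-E zero zero _ _ = begin
      L δ
        ≈⟨ Σ±-cong-< K {g = λ α → a ^ K * δ α}
             (λ where zero    _ → *-congʳ (≡⇒≋ (cong (a ^_) (ℕ.+-identityʳ K)))
                      (suc k) _ → ≋-trans (zeroʳ _) (≋-sym (zeroʳ _)))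
             (λ k _ → ≋-trans (zeroʳ _) (≋-sym (zeroʳ _))) ⟩
      Σ± K (λ α → a ^ K * δ α)
        ≈⟨ Σ±-*ˡ K (a ^ K) δ ⟩
      a ^ K * Σ± K δ
        ≈⟨ *-congˡ Σ±-δ ⟩
      a ^ K * (1# * 1#) ∎
      where
      open ≋-Reasoning
      opaque
        unfolding Σ±
        Σ±-δ : ∀ {M} → Σ± K δ ≋[ M ] 1# * 1#
        Σ±-δ = ≋-trans (+-cong (+-congˡ (Σ<-zero K′ (λ _ → ≋-refl))) (Σ<-zero K (λ _ → ≋-refl)))
          (solve 0 (con 1ℤ :+ con 0ℤ :+ con 0ℤ := con 1ℤ :* con 1ℤ) ≋-refl)
    L-E {M} zero (suc m) _ m<K′ = begin
      L (E zero (suc m))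
        ≈⟨ L-+-* (p ^ suc m) (E zero m) (λ α → E zero m (ℤ.suc α)) ⟩
      L (E zero m) + p * p ^ m * L (λ α → E zero m (ℤ.suc α))
        ≈⟨ +-congˡ (≋-trans (*-congʳ (*-congʳ (≋-sym a*b≋p)))
             (solve 4 (λ a b x y → a :* b :* x :* y := b :* x :* (a :* y)) ≋-refl a b (p ^ m) _)) ⟩
      L (E zero m) + b * p ^ m * (a * L (λ α → E zero m (ℤ.suc α)))
        ≈⟨ +-congˡ (*-congˡ (≋-trans (a*L _) (Σ±-suc {f = λ α → w α * E zero m α}
             (w*0 (w -[1+ K′ ]) (E-zero⁻′ zero m≤K′)) (w*0 (w (+ suc K′)) (E-zero⁺′ m (s≤s z≤n)))))) ⟩
      L (E zero m) + b * p ^ m * L (E zero m)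
        ≈⟨ solve 3 (λ l b x → l :+ b :* x :* l := l :* (con 1ℤ :+ b :* x)) ≋-refl (L (E zero m)) b (p ^ m) ⟩
      L (E zero m) * (1# + b * p ^ m)
        ≈⟨ *-congʳ (L-E zero m z≤n m≤K′) ⟩
      a ^ K * (Π< m (λ i → 1# + b * p ^ i) * 1#) * (1# + b * p ^ m)
        ≈⟨ solve 3 (λ k x y → k :* (x :* con 1ℤ) :* y := k :* (x :* y :* con 1ℤ)) ≋-refl
             (a ^ K) (Π< m (λ i → 1# + b * p ^ i)) (1# + b * p ^ m) ⟩
      a ^ K * (Π< m (λ i → 1# + b * p ^ i) * (1# + b * p ^ m) * 1#) ∎
      where
      open ≋-Reasoning
      m≤K′ = ℕ.<⇒≤ m<K′
    L-E {M} (suc n) m n<K′ m≤K′ = begin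
      L (E (suc n) m)
        ≈⟨ L-+-* (p ^ n) (E n m) (λ α → E n m (ℤ.pred α)) ⟩
      L (E n m) + p ^ n * L (λ α → E n m (ℤ.pred α))
        ≈⟨ +-congˡ (*-congˡ (begin
             L (λ α → E n m (ℤ.pred α))
               ≈⟨ Σ±-suc {f = λ α → w α * E n m (ℤ.pred α)}
                    (w*0 (w -[1+ K′ ]) (subst (λ k → E n m -[1+ k ] ≋[ M ] 0#)
                        (trans (ℕ.+-suc m (K′ ∸ m)) (cong suc (ℕ.m+[n∸m]≡n m≤K′))) (E-zero⁻ n m (suc (K′ ∸ m)))))
                    (w*0 (w (+ suc K′)) (E-zero⁺′ m n<K′)) ⟨
             Σ± K (λ α → w (ℤ.suc α) * E n m (ℤ.pred (ℤ.suc α)))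
               ≈⟨ Σ±-cong K (λ α → *-congˡ (≡⇒≋ (cong (E n m) (ℤ.pred-suc α)))) ⟩
             Σ± K (λ α → w (ℤ.suc α) * E n m α)
               ≈⟨ a*L (E n m) ⟨
             a * L (E n m) ∎)) ⟩
      L (E n m) + p ^ n * (a * L (E n m))
        ≈⟨ solve 3 (λ l a x → l :+ x :* (a :* l) := l :* (con 1ℤ :+ a :* x)) ≋-refl (L (E n m)) a (p ^ n) ⟩
      L (E n m) * (1# + a * p ^ n)
        ≈⟨ *-congʳ (L-E n m (ℕ.<⇒≤ n<K′) m≤K′) ⟩
      a ^ K * (Π< m (λ i → 1# + b * p ^ i) * Π< n (λ i → 1# + a * p ^ i)) * (1# + a * p ^ n)
        ≈⟨ solve 4 (λ k x y z → k :* (x :* y) :* z := k :* (x :* (y :* z))) ≋-refl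
             (a ^ K) (Π< m (λ i → 1# + b * p ^ i)) (Π< n (λ i → 1# + a * p ^ i)) (1# + a * p ^ n) ⟩
      a ^ K * (Π< m (λ i → 1# + b * p ^ i) * Π< (suc n) (λ i → 1# + a * p ^ i)) ∎
      where open ≋-Reasoning

  -- The triple product in the form ∑_α (-1)^α q^(c α + d T α), with d = c + c′.
  module Theta (c c′ : ℕ) (1≤c′ : 1 ≤ c′) where
    d = c ℕ.+ c′
    p = q^ d
    a = - q^ c
    b = - q^ c′

    -- The number c α + d T α. At α = -j it equals c′ j + d T j, the same form with c and c′
    -- exchanged, so that it is visibly a natural number.
    exponent : ℤ → ℕ
    exponent (+ k)    = k ℕ.* c ℕ.+ triangle k ℕ.* d
    exponent -[1+ k ] = suc k ℕ.* c′ ℕ.+ triangle (suc k) ℕ.* d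

    exponent≡ : ∀ α → + exponent α ≡ + d ℤ.* + T α ℤ.+ + c ℤ.* α
    exponent≡ (+ k) = begin
      + (k ℕ.* c) ℤ.+ + (triangle k ℕ.* d)         ≡⟨ cong₂ ℤ._+_ (ℤ.pos-* k c) (ℤ.pos-* (triangle k) d) ⟩
      + k ℤ.* + c ℤ.+ + triangle k ℤ.* + d         ≡⟨ lemma (+ k) (+ c) (+ triangle k) (+ d) ⟩
      + d ℤ.* + triangle k ℤ.+ + c ℤ.* + k         ∎
      where
      open ≡-Reasoning
      lemma : ∀ k c t d → k ℤ.* c ℤ.+ t ℤ.* d ≡ d ℤ.* t ℤ.+ c ℤ.* k
      lemma = solve-∀
    exponent≡ -[1+ k ] = begin
      + (suc k ℕ.* c′) ℤ.+ + (triangle (suc k) ℕ.* d)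
        ≡⟨ cong₂ ℤ._+_ (ℤ.pos-* (suc k) c′) (ℤ.pos-* (triangle (suc k)) d) ⟩
      + suc k ℤ.* + c′ ℤ.+ + triangle (suc k) ℤ.* + d
        ≡⟨ lemma (+ suc k) (+ c) (+ c′) (+ triangle (suc k)) ⟩
      + d ℤ.* (+ triangle (suc k) ℤ.+ + suc k) ℤ.+ + c ℤ.* -[1+ k ] ∎
      where
      open ≡-Reasoning
      lemma : ∀ k c c′ t → k ℤ.* c′ ℤ.+ t ℤ.* (c ℤ.+ c′) ≡ (c ℤ.+ c′) ℤ.* (t ℤ.+ k) ℤ.+ c ℤ.* (ℤ.- k)
      lemma = solve-∀

    1≤d : 1 ≤ d
    1≤d = ℕ.≤-trans 1≤c′ (ℕ.m≤n+m c′ c)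

    open JacobiTripleLimit p (q^≋0 ℕ.≤-refl) 1≤d public

    a*b≋p : ∀ {M} → a * b ≋[ M ] p
    a*b≋p = ≋-trans (solve 2 (λ x y → (:- x) :* (:- y) := x :* y) ≋-refl (q^ c) (q^ c′)) (q^-* c c′)

    term : ℤ → PowerSeries
    term α = ι (sgn α) * q^ exponent α

    -q^-^ : ∀ {M} c k → (- q^ c) ^ k ≋[ M ] ι (-1ℤ ℤ.^ k) * q^ (k ℕ.* c)
    -q^-^ c zero    = ≋-trans (≋-sym (*-identityˡ _)) (*-congˡ (≋-sym q^0≋1))
    -q^-^ c (suc k) = begin
      - q^ c * (- q^ c) ^ k                            ≈⟨ *-congˡ (-q^-^ c k) ⟩
      - q^ c * (ι (-1ℤ ℤ.^ k) * q^ (k ℕ.* c))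
        ≈⟨ solve 3 (λ x y z → (:- x) :* (y :* z) := con -1ℤ :* y :* (x :* z)) ≋-refl (q^ c) (ι (-1ℤ ℤ.^ k))
            (q^ (k ℕ.* c)) ⟩
      ι -1ℤ * ι (-1ℤ ℤ.^ k) * (q^ c * q^ (k ℕ.* c))    ≈⟨ *-cong (≋-sym (ι-* -1ℤ (-1ℤ ℤ.^ k))) (q^-* c (k ℕ.* c)) ⟩
      ι (-1ℤ ℤ.^ suc k) * q^ (suc k ℕ.* c)             ∎
      where open ≋-Reasoning

    term≋ : ∀ {M} s x y t → x ≋[ M ] ι s * q^ y → x * p ^ t ≋[ M ] ι s * q^ (y ℕ.+ t ℕ.* d)
    term≋ s x y t e = begin
      x * p ^ t                         ≈⟨ *-cong e (q^-^ d t) ⟩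
      ι s * q^ y * q^ (t ℕ.* d)         ≈⟨ *-assoc _ _ _ ⟩
      ι s * (q^ y * q^ (t ℕ.* d))       ≈⟨ *-congˡ (q^-* y (t ℕ.* d)) ⟩
      ι s * q^ (y ℕ.+ t ℕ.* d)          ∎
      where open ≋-Reasoning

    cancel-a^ : ∀ {M f g} k → a ^ k * f ≋[ k ℕ.* c ℕ.+ M ] a ^ k * g → f ≋[ M ] g
    cancel-a^ {M} {f} {g} k e = q^-cancelˡ (k ℕ.* c) (begin
      q^ (k ℕ.* c) * f     ≈⟨ factor f ⟨
      ι s * (a ^ k * f)    ≈⟨ *-congˡ e ⟩
      ι s * (a ^ k * g)    ≈⟨ factor g ⟩
      q^ (k ℕ.* c) * g     ∎)
      where
      open ≋-Reasoning
      s = -1ℤ ℤ.^ k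
      factor : ∀ {M} h → ι s * (a ^ k * h) ≋[ M ] q^ (k ℕ.* c) * h
      factor h = begin
        ι s * (a ^ k * h)                    ≈⟨ *-congˡ (*-congʳ (-q^-^ c k)) ⟩
        ι s * (ι s * q^ (k ℕ.* c) * h)       ≈⟨ solve 3 (λ s x h → s :* (s :* x :* h) := s :* s :* (x :* h))
            ≋-refl (ι s) (q^ (k ℕ.* c)) h ⟩
        ι s * ι s * (q^ (k ℕ.* c) * h)       ≈⟨ *-congʳ (≋-trans (≋-sym (ι-* s s)) (≡⇒≋ (cong ι (-1^k*-1^k≡1 k)))) ⟩
        1# * (q^ (k ℕ.* c) * h)              ≈⟨ *-identityˡ _ ⟩
        q^ (k ℕ.* c) * h                     ∎

    -- Both sides are first compared after multiplication by a^K, where `L-E` and `E-limit` give N d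
    -- digits; cancelling a^K, which is q^(K c) up to sign, then leaves M of them.
    theta : ∀ {M N X} → c ℕ.+ M ≤ N → N ℕ.+ N ≤ X →
            Π< N (λ i → 1# + b * p ^ i) * Π< N (λ i → 1# + a * p ^ i) * poch X ≋[ M ] Σ± (suc N) term
    theta {M} {N} {X} c+M≤N 2N≤X = cancel-a^ K (weaken ([1+N]c+M≤N[c+c′] {c} {c′} {M} {N} 1≤c′ c+M≤N) (begin
      a ^ K * (product * poch X)                    ≈⟨ *-assoc _ _ _ ⟨
      a ^ K * product * poch X                      ≈⟨ *-congʳ (L-E N N ℕ.≤-refl ℕ.≤-refl) ⟨
      L (E N N) * poch X                            ≈⟨ *-comm _ _ ⟩
      poch X * L (E N N)                            ≈⟨ Σ±-*ˡ K (poch X) _ ⟨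
      Σ± K (λ α → poch X * (w α * E N N α))
        ≈⟨ Σ±-cong K (λ α → ≋-trans (solve 3 (λ x w e → x :* (w :* e) := w :* (e :* x)) ≋-refl (poch X) (w α) (E N N α))
             (*-congˡ (E-limit {N} {N} {N} 2N≤X ℕ.≤-refl ℕ.≤-refl α))) ⟩
      Σ± K (λ α → w α * p ^ T α)                    ≈⟨ Σ±-cong-< K (λ k _ → nonneg k) (λ k k<K → neg k (ℕ.≤-pred k<K)) ⟩
      Σ± K (λ α → a ^ K * term α)                   ≈⟨ Σ±-*ˡ K (a ^ K) term ⟩
      a ^ K * Σ± K term                             ∎))
      where
      open Evaluation {p} {a} {b} a*b≋p N
      open ≋-Reasoning
      K = suc N
      product = Π< N (λ i → 1# + b * p ^ i) * Π< N (λ i → 1# + a * p ^ i)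

      nonneg : ∀ {M} k → w (+ k) * p ^ T (+ k) ≋[ M ] a ^ K * term (+ k)
      nonneg k = begin
        a ^ (K ℕ.+ k) * p ^ triangle k          ≈⟨ *-congʳ (^-+ a K k) ⟩
        a ^ K * a ^ k * p ^ triangle k          ≈⟨ *-assoc _ _ _ ⟩
        a ^ K * (a ^ k * p ^ triangle k)        ≈⟨ *-congˡ
            (term≋ (-1ℤ ℤ.^ k) (a ^ k) (k ℕ.* c) (triangle k) (-q^-^ c k)) ⟩
        a ^ K * term (+ k)                      ∎

      neg : ∀ {M} k → k ≤ N → w -[1+ k ] * p ^ T -[1+ k ] ≋[ M ] a ^ K * term -[1+ k ]
      neg k k≤N = begin
        -- T(-k-1) = T(k+1) + (k+1), and the extra p^(k+1) equals a^(k+1) b^(k+1): its powers of a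
        -- complete a^(N-k) to a^K, its powers of b give the sign and the c′ part of the exponent.
        a ^ (N ∸ k) * p ^ (t ℕ.+ suc k)                         ≈⟨ *-congˡ (^-+ p t (suc k)) ⟩
        a ^ (N ∸ k) * (p ^ t * p ^ suc k)
          ≈⟨ *-congˡ (*-congˡ (≋-trans (^-cong (suc k) (≋-sym a*b≋p)) (*-^ a b (suc k)))) ⟩
        a ^ (N ∸ k) * (p ^ t * (a ^ suc k * b ^ suc k))
          ≈⟨ solve 4 (λ u x y z → u :* (x :* (y :* z)) := u :* y :* (z :* x)) ≋-refl (a ^ (N ∸ k)) (p ^ t)
              (a ^ suc k) (b ^ suc k) ⟩
        a ^ (N ∸ k) * a ^ suc k * (b ^ suc k * p ^ t)           ≈⟨ *-congʳ (^-+ a (N ∸ k) (suc k)) ⟨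
        a ^ (N ∸ k ℕ.+ suc k) * (b ^ suc k * p ^ t)
          ≈⟨ *-cong (≡⇒≋ (cong (a ^_) (trans (ℕ.+-suc (N ∸ k) k) (cong suc (ℕ.m∸n+n≡m k≤N)))))
               (term≋ (-1ℤ ℤ.^ suc k) (b ^ suc k) (suc k ℕ.* c′) t (-q^-^ c′ (suc k))) ⟩
        a ^ K * term -[1+ k ]                                   ∎
        where t = triangle (suc k)

  -- The series A k and binomialA α

  recip-* : ∀ {M} f g (f0 : f 0 ≡ 1ℤ) (g0 : g 0 ≡ 1ℤ) (fg0 : (f *ˢ g) 0 ≡ 1ℤ) →
            recip (f *ˢ g) fg0 ≋[ M ] recip f f0 * recip g g0
  recip-* {M} f g f0 g0 fg0 = *-cancelˡ-unit (≋-trans (mod λ where zero _ → fg0; (suc _) (s≤s ())) 1ˢ≋1#) (begin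
    (f *ˢ g) * recip (f *ˢ g) fg0             ≈⟨ recip-inverse (f *ˢ g) fg0 ⟩
    1#                                        ≈⟨ *-identityˡ 1# ⟨
    1# * 1#                                   ≈⟨ *-cong (recip-inverse f f0) (recip-inverse g g0) ⟨
    f * recip f f0 * (g * recip g g0)
      ≈⟨ solve 4 (λ f r g s → f :* r :* (g :* s) := f :* g :* (r :* s)) ≋-refl f (recip f f0) g (recip g g0) ⟩
    f * g * (recip f f0 * recip g g0)         ≈⟨ *-congʳ *ˢ≋* ⟨
    (f *ˢ g) * (recip f f0 * recip g g0)      ∎)
    where open ≋-Reasoning

  ∑-increasing-truncate : ∀ {M N c} k s F (hF : OrderBound c (suc k) F) → M ≤ N →
    ∑-increasing (suc k) s F hF ≋[ M ] Σ< N
        (λ j → ∑-increasing k (suc (s ℕ.+ j)) (F ∘ (s ℕ.+ j ∷_)) (OrderBound-∷ (s ℕ.+ j) hF))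
  ∑-increasing-truncate {c = c} k s F hF = ∑^∞-truncate _ λ j →
    O-≤ (ℕ.≤-trans (ℕ.≤-trans (ℕ.m≤n+m j (suc s)) (ℕ.m≤n+m (suc (s ℕ.+ j)) c)) (ℕ.m≤m+n _ k))
        (O-∑-increasing k (suc (s ℕ.+ j)) (F ∘ (s ℕ.+ j ∷_)) (OrderBound-∷ (s ℕ.+ j) hF))

  -- The order bounds differ in the application: `A-term` with first entry u fixed carries the bound
  -- 1 + u, while `A-term` of the remaining entries starts again from 0.
  ∑-increasing-*ˡ : ∀ {M c c′} k s {F G} (hF : OrderBound c k F) (hG : OrderBound c′ k G) g →
    (∀ us → F us ≋[ M ] g * G us) → ∑-increasing k s F hF ≋[ M ] g * ∑-increasing k s G hG
  ∑-increasing-*ˡ zero    s hF hG g F≋gG = F≋gG []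
  ∑-increasing-*ˡ {M} (suc k) s {F} {G} hF hG g F≋gG = begin
    ∑-increasing (suc k) s F hF
      ≈⟨ ∑-increasing-truncate k s F hF ℕ.≤-refl ⟩
    Σ< M (λ j → ∑-increasing k (suc (s ℕ.+ j)) (F ∘ (s ℕ.+ j ∷_)) (OrderBound-∷ (s ℕ.+ j) hF))
      ≈⟨ Σ<-cong M (λ j → ∑-increasing-*ˡ k (suc (s ℕ.+ j)) (OrderBound-∷ (s ℕ.+ j) hF) (OrderBound-∷ (s ℕ.+ j) hG) g
           (λ us → F≋gG (s ℕ.+ j ∷ us))) ⟩
    Σ< M (λ j → g * ∑-increasing k (suc (s ℕ.+ j)) (G ∘ (s ℕ.+ j ∷_)) (OrderBound-∷ (s ℕ.+ j) hG))
      ≈⟨ Σ<-*ˡ M g _ ⟩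
    g * Σ< M (λ j → ∑-increasing k (suc (s ℕ.+ j)) (G ∘ (s ℕ.+ j ∷_)) (OrderBound-∷ (s ℕ.+ j) hG))
      ≈⟨ *-congˡ (∑-increasing-truncate k s G hG ℕ.≤-refl) ⟨
    g * ∑-increasing (suc k) s G hG ∎
    where open ≋-Reasoning

  -- The contribution of a single entry to a term of `A`; thus `A k` is the k-th elementary
  -- symmetric function of x 0, x 1, x 2 and so on.
  x : ℕ → PowerSeries
  x u = q^ suc u * recip ((1ˢ -ˢ q^ suc u) ^ˢ 2) refl

  x≋0 : ∀ {M} u → M ≤ suc u → x u ≋[ M ] 0#
  x≋0 u M≤1+u = ≋-trans (*-congʳ (q^≋0 M≤1+u)) (zeroˡ _)

  x*[1-q^]² : ∀ {M} u → x u * ((1# - q^ suc u) * (1# - q^ suc u)) ≋[ M ] q^ suc u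
  x*[1-q^]² u = begin
    q^ suc u * r * (y * y)          ≈⟨ solve 3 (λ q r y → q :* r :* (y :* y) := q :* (y :* (y :* con 1ℤ) :* r))
        ≋-refl (q^ suc u) r y ⟩
    q^ suc u * (y ^ 2 * r)          ≈⟨ *-congˡ
        (*-congʳ (≋-trans (^ˢ≋^ (1ˢ -ˢ q^ suc u) 2) (^-cong 2 (≋-trans -ˢ≋- (+-congʳ 1ˢ≋1#))))) ⟨
    q^ suc u * ((1ˢ -ˢ q^ suc u) ^ˢ 2 * r) ≈⟨ *-congˡ (recip-inverse ((1ˢ -ˢ q^ suc u) ^ˢ 2) refl) ⟩
    q^ suc u * 1#                   ≈⟨ *-identityʳ _ ⟩
    q^ suc u                        ∎
    where
    open ≋-Reasoning
    y = 1# - q^ suc u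
    r = recip ((1ˢ -ˢ q^ suc u) ^ˢ 2) refl

  A-term-∷ : ∀ {M k} u (us : Vec ℕ k) → A-term (u ∷ us) ≋[ M ] x u * A-term us
  A-term-∷ u us = begin
    A-term (u ∷ us)                                   ≈⟨ *ˢ≋* ⟩
    q^ (suc u ℕ.+ s) * recip (A-denominator (u ∷ us)) (A-denominator-0 (u ∷ us))
      ≈⟨ *-cong (≋-sym (q^-* (suc u) s))
          (recip-* ((1ˢ -ˢ q^ suc u) ^ˢ 2) (A-denominator us) refl (A-denominator-0 us) (A-denominator-0 (u ∷ us))) ⟩
    q^ suc u * q^ s * (r * r′)                        ≈⟨ solve 4
        (λ a b c d → a :* b :* (c :* d) := a :* c :* (b :* d)) ≋-refl (q^ suc u) (q^ s) r r′ ⟩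
    x u * (q^ s * r′)                                 ≈⟨ *-congˡ *ˢ≋* ⟨
    x u * A-term us                                   ∎
    where
    open ≋-Reasoning
    s = sum (map suc us)
    r = recip ((1ˢ -ˢ q^ suc u) ^ˢ 2) refl
    r′ = recip (A-denominator us) (A-denominator-0 us)

  A-from : ℕ → ℕ → PowerSeries
  A-from s k = ∑-increasing k s A-term (A-term-order k)

  A-from-zero : ∀ {M} s → A-from s 0 ≋[ M ] 1#
  A-from-zero s = begin
    q^ 0 *ˢ recip 1ˢ refl  ≈⟨ *ˢ≋* ⟩
    1ˢ * recip 1ˢ refl     ≈⟨ recip-inverse 1ˢ refl ⟩
    1#                     ∎
    where open ≋-Reasoning

  A-from-truncate : ∀ {M} N s k → M ≤ N → A-from s (suc k) ≋[ M ] Σ< N (λ j → x (s ℕ.+ j) * A-from (suc (s ℕ.+ j)) k)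
  A-from-truncate N s k M≤N = ≋-trans (∑-increasing-truncate k s A-term (A-term-order (suc k)) M≤N)
    (Σ<-cong N (λ j → ∑-increasing-*ˡ k (suc (s ℕ.+ j)) (OrderBound-∷ (s ℕ.+ j) (A-term-order (suc k))) (A-term-order k)
      (x (s ℕ.+ j)) (A-term-∷ (s ℕ.+ j))))

  -- The tuples are separated by whether their first entry is s. The truncation at M + 1 leaves
  -- exactly M terms once the first is split off.
  A-from-suc : ∀ {M} s k → A-from s (suc k) ≋[ M ] x s * A-from (suc s) k + A-from (suc s) (suc k)
  A-from-suc {M} s k = begin
    A-from s (suc k)
      ≈⟨ A-from-truncate (suc M) s k (ℕ.n≤1+n M) ⟩
    term (s ℕ.+ 0) + Σ< M (λ j → term (s ℕ.+ suc j))
      ≈⟨ +-cong (≡⇒≋ (cong term (ℕ.+-identityʳ s))) (Σ<-cong M (λ j → ≡⇒≋ (cong term (ℕ.+-suc s j)))) ⟩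
    term s + Σ< M (λ j → term (suc s ℕ.+ j))
      ≈⟨ +-congˡ (A-from-truncate M (suc s) k ℕ.≤-refl) ⟨
    x s * A-from (suc s) k + A-from (suc s) (suc k) ∎
    where
    open ≋-Reasoning
    term : ℕ → PowerSeries
    term u = x u * A-from (suc u) k

  -- The k-th elementary symmetric polynomial of x s , … , x (s + d - 1).
  e : ℕ → ℕ → ℕ → PowerSeries
  e s zero    zero    = 1#
  e s zero    (suc k) = 0#
  e s (suc d) zero    = 1#
  e s (suc d) (suc k) = x s * e (suc s) d k + e (suc s) d (suc k)

  e-0 : ∀ {M} s d → e s d 0 ≋[ M ] 1#
  e-0 s zero    = ≋-refl
  e-0 s (suc d) = ≋-refl

  -- Modulo q^M the variables x u with u ≥ s + d vanish, which leaves finitely many.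
  A-from≋e : ∀ {M} s d k → M ≤ s ℕ.+ d → A-from s k ≋[ M ] e s d k
  A-from≋e s d zero _ = ≋-trans (A-from-zero s) (≋-sym (e-0 s d))
  A-from≋e {M} s zero (suc k) M≤ = ≋-trans (A-from-truncate M s k ℕ.≤-refl)
    (Σ<-zero M (λ j → ≋-trans (*-congʳ
        (x≋0 (s ℕ.+ j) (ℕ.≤-trans M≤ (ℕ.≤-trans (ℕ.+-monoʳ-≤ s z≤n) (ℕ.n≤1+n _))))) (zeroˡ _)))
  A-from≋e {M} s (suc d) (suc k) M≤ = ≋-trans (A-from-suc s k)
    (+-cong (*-congˡ (A-from≋e (suc s) d k M≤′)) (A-from≋e (suc s) d (suc k) M≤′))
    where M≤′ = ℕ.≤-trans M≤ (ℕ.≤-reflexive (ℕ.+-suc s d))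

  -- The recursion of `e` splits off the first variable, as `A-from` does. Growing the product from
  -- N to N + 1 factors appends a last one, and symmetry of `e` has to be proved to that extent.
  e-last : ∀ {M} s d k → e s (suc d) (suc k) ≋[ M ] e s d (suc k) + x (s ℕ.+ d) * e s d k
  e-last s zero zero = ≋-trans (+-comm _ _) (+-congˡ (*-congʳ (≡⇒≋ (cong x (sym (ℕ.+-identityʳ s))))))
  e-last s zero (suc k) = ≋-trans (+-comm _ _) (+-congˡ (*-congʳ (≡⇒≋ (cong x (sym (ℕ.+-identityʳ s))))))
  e-last s (suc d) k = begin
    x s * e (suc s) (suc d) k + e (suc s) (suc d) (suc k)
      ≈⟨ +-congˡ (≋-trans (e-last (suc s) d k) (+-congˡ (*-congʳ (≡⇒≋ (cong x (sym (ℕ.+-suc s d))))))) ⟩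
    x s * e (suc s) (suc d) k + (e (suc s) d (suc k) + x (s ℕ.+ suc d) * e (suc s) d k)
      ≈⟨ lemma k ⟩
    (x s * e (suc s) d k + e (suc s) d (suc k)) + x (s ℕ.+ suc d) * e s (suc d) k ∎
    where
    open ≋-Reasoning
    lemma : ∀ {M} k → x s * e (suc s) (suc d) k + (e (suc s) d (suc k) + x (s ℕ.+ suc d) * e (suc s) d k) ≋[ M ]
                      (x s * e (suc s) d k + e (suc s) d (suc k)) + x (s ℕ.+ suc d) * e s (suc d) k
    lemma zero = ≋-trans (+-cong (*-congˡ (≋-sym (e-0 (suc s) d))) (+-congˡ (*-congˡ (e-0 (suc s) d))))
        (≋-sym (+-assoc _ _ _))
    lemma (suc k) = ≋-trans (+-congʳ
        (*-congˡ (≋-trans (e-last (suc s) d k) (+-congˡ (*-congʳ (≡⇒≋ (cong x (sym (ℕ.+-suc s d)))))))))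
      (solve 5 (λ x y a b c → x :* (b :+ y :* a) :+ (c :+ y :* b) := (x :* b :+ c) :+ y :* (x :* a :+ b)) ≋-refl
        (x s) (x (s ℕ.+ suc d)) (e (suc s) d k) (e (suc s) d (suc k)) (e (suc s) d (suc (suc k))))

  e-zero : ∀ {M} s {d k} → d < k → e s d k ≋[ M ] 0#
  e-zero s {zero}  {suc k} _ = ≋-refl
  e-zero s {suc d} {suc k} (s≤s d<k) = ≋-trans
    (+-cong (≋-trans (*-congˡ (e-zero (suc s) d<k)) (zeroʳ _)) (e-zero (suc s) (ℕ.m<n⇒m<1+n d<k))) (+-identityˡ 0#)

  -- The coefficient of z^α in ∏_{i<N} (1 + x_i (z + 2 + z⁻¹)), expanded in powers of z + 2 + z⁻¹.
  U : ℕ → ℤ → PowerSeries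
  U N α = Σ< (suc N) (λ k → ι (bin k α) * e 0 N k)

  U-suc : ∀ {M} N α → U (suc N) α ≋[ M ] U N α + x N * ((U N (ℤ.pred α) + U N (ℤ.suc α)) + (U N α + U N α))
  U-suc {M} N α = begin
    term 0 + Σ< (suc N) (λ k → ι (bin (suc k) α) * e 0 (suc N) (suc k))
      ≈⟨ +-cong (*-congˡ (≋-sym (e-0 0 N))) (separate (suc N)) ⟩
    term′ 0 + (Σ< (suc N) (term′ ∘ suc) + x N * _)
      ≈⟨ +-assoc _ _ _ ⟨
    Σ< (suc (suc N)) term′ + x N * _
      ≈⟨ +-congʳ (Σ<-tail {f = term′} (ℕ.n≤1+n (suc N)) (λ k N<k → ≋-trans (*-congˡ (e-zero 0 N<k)) (zeroʳ _))) ⟩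
    U N α + x N * ((U N (ℤ.pred α) + U N (ℤ.suc α)) + (U N α + U N α)) ∎
    where
    open ≋-Reasoning
    term term′ : ℕ → PowerSeries
    term  k = ι (bin k α) * e 0 (suc N) k
    term′ k = ι (bin k α) * e 0 N k
    expand : ∀ k → ι (bin (suc k) α) * e 0 (suc N) (suc k) ≋[ M ] term′ (suc k) + x N *
      ((ι (bin k (ℤ.pred α)) * e 0 N k + ι (bin k (ℤ.suc α)) * e 0 N k) + (term′ k + term′ k))
    expand k = begin
      ι (bin (suc k) α) * e 0 (suc N) (suc k)
        ≈⟨ *-congˡ (e-last 0 N k) ⟩
      ι (bin (suc k) α) * (e 0 N (suc k) + x N * e 0 N k)
        ≈⟨ solve 4 (λ b c y d → b :* (c :+ y :* d) := b :* c :+ y :* (b :* d)) ≋-refl (ι (bin (suc k) α))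
            (e 0 N (suc k)) (x N) (e 0 N k) ⟩
      term′ (suc k) + x N * (ι (bin (suc k) α) * e 0 N k)
        ≈⟨ +-congˡ (*-congˡ (≋-trans (*-congʳ (≋-trans (ι-+ _ _) (+-cong (ι-+ _ _) (ι-+ _ _))))
             (≋-trans (distribʳ _ _ _) (+-cong (distribʳ _ _ _) (distribʳ _ _ _))))) ⟩
      term′ (suc k) + x N * ((ι (bin k (ℤ.pred α)) * e 0 N k + ι (bin k (ℤ.suc α)) * e 0 N k) + (term′ k + term′ k)) ∎
    separate : ∀ K → Σ< K (λ k → ι (bin (suc k) α) * e 0 (suc N) (suc k)) ≋[ M ] Σ< K (term′ ∘ suc) + x N *
      ((Σ< K (λ k → ι (bin k (ℤ.pred α)) * e 0 N k) + Σ< K (λ k → ι (bin k (ℤ.suc α)) * e 0 N k)) +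
          (Σ< K term′ + Σ< K term′))
    separate K = ≋-trans (Σ<-cong K expand) (≋-trans (Σ<-+ K _ _) (+-congˡ (≋-trans (Σ<-*ˡ K (x N) _)
      (*-congˡ (≋-trans (Σ<-+ K _ _) (+-cong (Σ<-+ K _ _) (Σ<-+ K _ _)))))))

  -- `bin k α` vanishes for k < |α|, so the sum may start at 0 and the binomial coefficient may be
  -- replaced by `bin` throughout.
  binomialA≋U : ∀ {M N} α → M ≤ N → binomialA α ≋[ M ] U N α
  binomialA≋U {M} {N} α M≤N = truncated (suc N) (ℕ.m≤n⇒m≤1+n M≤N)
    where
    open ≋-Reasoning
    term : ℕ → PowerSeries
    term k = ι (bin k α) * A k
    truncated : ∀ K → M ≤ K → binomialA α ≋[ M ] Σ< K (λ k → ι (bin k α) * e 0 N k)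
    truncated K M≤K = begin
      binomialA α
        ≈⟨ ∑^∞-truncate _ (λ j → O-≤ (ℕ.m≤n+m j (∣ α ∣)) (O-binomialA-term α (∣ α ∣ ℕ.+ j))) M≤K ⟩
      Σ< K (λ j → binomialA-term α (∣ α ∣ ℕ.+ j))
        ≈⟨ Σ<-cong K (λ j → ≋-trans (≋-sym (ι-*-• _ _))
             (*-congʳ (≡⇒≋ (cong ι (sym (bin≡C (∣ α ∣ ℕ.+ j) α (ℕ.m≤m+n (∣ α ∣) j))))))) ⟩
      Σ< K (λ j → term (∣ α ∣ ℕ.+ j))
        ≡⟨ cong (λ n → Σ< n (λ j → term (∣ α ∣ ℕ.+ j))) (ℕ.m+n∸m≡n (∣ α ∣) K) ⟨
      Σ< (∣ α ∣ ℕ.+ K ∸ ∣ α ∣) (λ j → term (∣ α ∣ ℕ.+ j))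
        ≈⟨ Σ<-drop {f = term} (ℕ.m≤m+n (∣ α ∣) K)
            (λ k k<∣α∣ → ≋-trans (*-congʳ (≡⇒≋ (cong ι (bin-zero k α k<∣α∣)))) (zeroˡ _)) ⟨
      Σ< (∣ α ∣ ℕ.+ K) term
        ≈⟨ Σ<-tail {f = term} (ℕ.m≤n+m K (∣ α ∣))
            (λ k K≤k → ≋-trans (*-congˡ (weaken (ℕ.≤-trans M≤K K≤k) (O⇒≋0 (O-A k)))) (zeroʳ _)) ⟩
      Σ< K term
        ≈⟨ Σ<-cong K (λ k → *-congˡ (A-from≋e 0 N k M≤N)) ⟩
      Σ< K (λ k → ι (bin k α) * e 0 N k) ∎

  binomialA≋0 : ∀ {M} α → M ≤ ∣ α ∣ → binomialA α ≋[ M ] 0#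
  binomialA≋0 α M≤∣α∣ = weaken M≤∣α∣ (O⇒≋0 (O-∑^∞-from (O-binomialA-term α)))

  qPochhammer≋poch : ∀ {M N} d (h : O[q^ 1 ] (q^ d)) → M ≤ N → qPochhammer (q^ d) (q^ d) h
      ≋[ M ] JacobiTriple.poch (q^ d) N
  qPochhammer≋poch {N = N} d h M≤N = ≋-trans (∏^∞-truncate _ (λ j → O⇒1-f≡1 (O-*ʳ (q^ d) (O-^ h j))) M≤N)
    (Π<-cong N (λ j → ≋-trans -ˢ≋- (+-cong 1ˢ≋1# (-‿cong (≋-trans *ˢ≋* (*-congˡ (^ˢ≋^ (q^ d) j)))))))

  P₁ : PowerSeries
  P₁ = qPochhammer (q^ 1) (q^ 1) (O-q^ 1)

  module _ where
    private p = q^ 1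
    open JacobiTripleLimit p (q^≋0 ℕ.≤-refl) ℕ.≤-refl

    x*[1-p]² : ∀ {M} N → x N * ((1# - p * p ^ N) * (1# - p * p ^ N)) ≋[ M ] p ^ suc N
    x*[1-p]² N = begin
      x N * ((1# - p ^ suc N) * (1# - p ^ suc N))     ≈⟨ *-congˡ
          (*-cong (+-congˡ (-‿cong p^≋q^)) (+-congˡ (-‿cong p^≋q^))) ⟩
      x N * ((1# - q^ suc N) * (1# - q^ suc N))       ≈⟨ x*[1-q^]² N ⟩
      q^ suc N                                        ≈⟨ p^≋q^ ⟨
      p ^ suc N                                       ∎
      where
      open ≋-Reasoning
      p^≋q^ : ∀ {M} → p ^ suc N ≋[ M ] q^ suc N
      p^≋q^ = ≋-trans (q^-^ 1 (suc N)) (≡⇒≋ (cong q^_ (ℕ.*-identityʳ (suc N))))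

    -- With y = q^(N+1) and x = y / (1 - y)², (1 - y)² (1 + x (z + 2 + z⁻¹)) = (1 + z y)(1 + z⁻¹ y).
    -- Hence (q;q)_N² clears all denominators, and the factor 1 + z from adding neighbours is the
    -- one at i = 0; this is why the first index of `E` is N + 1. The identity is exact for every N.
    U-adjacent : ∀ {M} N α → (U N α + U N (ℤ.pred α)) * (poch N * poch N) ≋[ M ] E (suc N) N α
    U-adjacent zero α = begin
      (U 0 α + U 0 (ℤ.pred α)) * (1# * 1#)    ≈⟨ *-congʳ (+-cong (U-zero α) (U-zero (ℤ.pred α))) ⟩
      (δ α + δ (ℤ.pred α)) * (1# * 1#)        ≈⟨ solve 2
          (λ a b → (a :+ b) :* (con 1ℤ :* con 1ℤ) := a :+ con 1ℤ :* b) ≋-refl (δ α) (δ (ℤ.pred α)) ⟩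
      δ α + 1# * δ (ℤ.pred α)                 ∎
      where
      open ≋-Reasoning
      bin-δ : ∀ α → ι (bin 0 α) ≡ δ α
      bin-δ (+ zero)  = refl
      bin-δ (+ suc _) = refl
      bin-δ -[1+ _ ]  = refl
      U-zero : ∀ {M} α → U 0 α ≋[ M ] δ α
      U-zero α = ≋-trans (+-identityʳ _) (≋-trans (*-identityʳ _) (≡⇒≋ (bin-δ α)))
    U-adjacent (suc N) α = begin
      (U (suc N) α + U (suc N) α₋) * (Q * z * (Q * z))
        ≈⟨ *-congʳ (+-cong (U-suc N α) (≋-trans (U-suc N α₋)
             (+-congˡ (*-congˡ (+-congʳ (+-congˡ (≡⇒≋ (cong (U N) (ℤ.suc-pred α))))))))) ⟩
      ((u₀ + x N * ((u₁ + v) + (u₀ + u₀))) + (u₁ + x N * ((u₂ + u₀) + (u₁ + u₁)))) * (Q * z * (Q * z))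
        ≈⟨ solve 7 (λ u₀ u₁ u₂ v x Q z →
             ((u₀ :+ x :* ((u₁ :+ v) :+ (u₀ :+ u₀))) :+ (u₁ :+ x :* ((u₂ :+ u₀) :+ (u₁ :+ u₁)))) :* (Q :* z :* (Q :* z))
             := (u₀ :+ u₁) :* (Q :* Q) :* (z :* z) :+ x :* (z :* z) :* (Q :* Q) :*
                 (v :+ u₀ :+ (u₁ :+ u₂) :+ con (+ 2) :* (u₀ :+ u₁)))
           ≋-refl u₀ u₁ u₂ v (x N) Q z ⟩
      (u₀ + u₁) * (Q * Q) * (z * z) + x N * (z * z) * (Q * Q) * (v + u₀ + (u₁ + u₂) + ι (+ 2) * (u₀ + u₁))
        ≈⟨ +-congˡ (*-congʳ (*-congʳ (x*[1-p]² N))) ⟩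
      (u₀ + u₁) * (Q * Q) * (z * z) + y * (Q * Q) * (v + u₀ + (u₁ + u₂) + ι (+ 2) * (u₀ + u₁))
        ≈⟨ solve 6 (λ u₀ u₁ u₂ v y Q →
             (u₀ :+ u₁) :* (Q :* Q) :* ((con 1ℤ :- y) :* (con 1ℤ :- y)) :+ y :* (Q :* Q) :*
                 (v :+ u₀ :+ (u₁ :+ u₂) :+ con (+ 2) :* (u₀ :+ u₁))
             := ((u₀ :+ u₁) :* (Q :* Q) :+ y :* ((v :+ u₀) :* (Q :* Q))) :+ y :*
                 ((u₁ :+ u₂) :* (Q :* Q) :+ y :* ((u₀ :+ u₁) :* (Q :* Q))))
           ≋-refl u₀ u₁ u₂ v y Q ⟩
      ((u₀ + u₁) * (Q * Q) + y * ((v + u₀) * (Q * Q))) + y * ((u₁ + u₂) * (Q * Q) + y * ((u₀ + u₁) * (Q * Q)))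
        ≈⟨ +-cong (+-cong (U-adjacent N α)
            (*-congˡ (≋-trans (*-congʳ (+-congˡ (≡⇒≋ (cong (U N) (sym (ℤ.pred-suc α)))))) (U-adjacent N (ℤ.suc α)))))
                  (*-congˡ (+-cong (U-adjacent N α₋)
                      (*-congˡ (≋-trans (U-adjacent N α) (≡⇒≋ (cong (E (suc N) N) (sym (ℤ.suc-pred α)))))))) ⟩
      (E (suc N) N α + y * E (suc N) N (ℤ.suc α)) + y * (E (suc N) N α₋ + y * E (suc N) N (ℤ.suc α₋))
        ≈⟨ +-cong (E-suc-m (suc N) N α) (*-congˡ (E-suc-m (suc N) N α₋)) ⟨
      E (suc N) (suc N) α + y * E (suc N) (suc N) α₋ ∎
      where
      open ≋-Reasoning
      α₋ = ℤ.pred α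
      u₀ = U N α
      u₁ = U N α₋
      u₂ = U N (ℤ.pred α₋)
      v  = U N (ℤ.suc α)
      Q  = poch N
      y  = p ^ suc N
      z  = 1# - y

    binomialA-adjacent : ∀ {M} α → (binomialA α + binomialA (ℤ.pred α)) * (P₁ * P₁ * P₁) ≋[ M ] q^ T α
    binomialA-adjacent {M} α = begin
      (binomialA α + binomialA (ℤ.pred α)) * (P₁ * P₁ * P₁)
        -- Two copies of (q;q)_∞ are cut at M to match the denominators in `U-adjacent`; the third
        -- is cut at 2M + 1, the total number of factors of `E (suc M) M`, as `E-limit` requires.
        ≈⟨ *-cong (+-cong (binomialA≋U α ℕ.≤-refl) (binomialA≋U (ℤ.pred α) ℕ.≤-refl))
                  (*-cong (*-cong (P₁≋poch ℕ.≤-refl) (P₁≋poch ℕ.≤-refl)) (P₁≋poch (ℕ.m≤n+m M (suc M)))) ⟩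
      (U M α + U M (ℤ.pred α)) * (poch M * poch M * poch (suc M ℕ.+ M))
        ≈⟨ *-assoc _ _ _ ⟨
      (U M α + U M (ℤ.pred α)) * (poch M * poch M) * poch (suc M ℕ.+ M)
        ≈⟨ *-congʳ (U-adjacent M α) ⟩
      E (suc M) M α * poch (suc M ℕ.+ M)
        ≈⟨ weaken (ℕ.≤-reflexive (sym (ℕ.*-identityʳ M))) (E-limit {M} {suc M} {M} ℕ.≤-refl (ℕ.n≤1+n M) ℕ.≤-refl α) ⟩
      p ^ T α
        ≈⟨ q^-^ 1 (T α) ⟩
      q^ (T α ℕ.* 1)
        ≡⟨ cong q^_ (ℕ.*-identityʳ (T α)) ⟩
      q^ T α ∎
      where
      open ≋-Reasoning
      P₁≋poch : ∀ {N} → M ≤ N → P₁ ≋[ M ] poch N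
      P₁≋poch = qPochhammer≋poch 1 (O-q^ 1)

  -- The sums S γ

  opaque
    unfolding Σ±

    ∑^ℤ-truncate : ∀ {M K} f (hf : ∀ β → O[q^ ∣ β ∣ ] (f β)) → M ≤ K → ∑^ℤ f hf ≋[ M ] Σ± K f
    ∑^ℤ-truncate f hf M≤K = ≋-trans +ˢ≋+ (+-cong
      (∑^∞-truncate (f ∘ +_) (hf ∘ +_) M≤K)
      (∑^∞-truncate (f ∘ -[1+_]) (λ k → O-≤ (ℕ.n≤1+n k) (hf -[1+ k ])) M≤K))

  S≋ : ∀ {M K} γ → M ≤ K → S γ ≋[ M ] Σ± K (λ β → ι (sgn β) * (binomialA (γ ℤ.- + 2 ℤ.* β) * binomialA β))
  S≋ {M} {K} γ M≤K = ≋-trans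
    (∑^ℤ-truncate _ (λ β → O-• (sgn β) (O-*ʳ (binomialA (γ ℤ.- + 2 ℤ.* β)) (O-∑^∞-from (O-binomialA-term β)))) M≤K)
    (Σ±-cong K (λ β → ≋-trans (≋-sym (ι-*-• (sgn β) _)) (*-congˡ *ˢ≋*)))

  P₁³ : PowerSeries
  P₁³ = P₁ * P₁ * P₁

  S+S-pred : ∀ {M K} γ → M ≤ K → (S γ + S (ℤ.pred γ)) * P₁³
      ≋[ M ] Σ± K (λ β → ι (sgn β) * (q^ T (γ ℤ.- + 2 ℤ.* β) * binomialA β))
  S+S-pred {M} {K} γ M≤K = begin
    (S γ + S (ℤ.pred γ)) * P₁³
      ≈⟨ ≋-trans (*-comm _ _) (*-congˡ (+-cong (S≋ γ M≤K) (S≋ (ℤ.pred γ) M≤K))) ⟩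
    P₁³ * (Σ± K (λ β → ι (sgn β) * (binomialA (γ ℤ.- + 2 ℤ.* β) * binomialA β)) +
           Σ± K (λ β → ι (sgn β) * (binomialA (ℤ.pred γ ℤ.- + 2 ℤ.* β) * binomialA β)))
      ≈⟨ *-congˡ (Σ±-+ K _ _) ⟨
    P₁³ * Σ± K (λ β → ι (sgn β) * (binomialA (γ ℤ.- + 2 ℤ.* β) * binomialA β) +
                      ι (sgn β) * (binomialA (ℤ.pred γ ℤ.- + 2 ℤ.* β) * binomialA β))
      ≈⟨ Σ±-*ˡ K P₁³ _ ⟨
    Σ± K (λ β → P₁³ * (ι (sgn β) * (binomialA (γ ℤ.- + 2 ℤ.* β) * binomialA β) +
                       ι (sgn β) * (binomialA (ℤ.pred γ ℤ.- + 2 ℤ.* β) * binomialA β)))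
      ≈⟨ Σ±-cong K (λ β → ≋-trans
           (solve 5 (λ p s a a′ b → p :* (s :* (a :* b) :+ s :* (a′ :* b)) := s :* ((a :+ a′) :* p :* b)) ≋-refl
              P₁³ (ι (sgn β)) (binomialA (γ ℤ.- + 2 ℤ.* β)) (binomialA (ℤ.pred γ ℤ.- + 2 ℤ.* β)) (binomialA β))
           (*-congˡ (*-congʳ (≋-trans (*-congʳ (+-congˡ (≡⇒≋ (cong binomialA (ℤ.+-assoc -1ℤ γ (ℤ.- (+ 2 ℤ.* β)))))))
              (binomialA-adjacent (γ ℤ.- + 2 ℤ.* β)))))) ⟩
    Σ± K (λ β → ι (sgn β) * (q^ T (γ ℤ.- + 2 ℤ.* β) * binomialA β)) ∎
    where open ≋-Reasoning

  -- Grouped by the factor 1 - w² of (1 + w)(1 - w²): each bracket completes the first copy of B,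
  -- the difference of the brackets completes the second.
  combination : ℤ → PowerSeries
  combination γ = (S γ + S (ℤ.pred γ)) - (S (γ ℤ.- + 2) + S (ℤ.pred (γ ℤ.- + 2)))

  combination≋ : ∀ {M K} γ → M ≤ K → combination γ * (P₁³ * P₁³) ≋[ M ]
                 Σ± (suc K) (λ β → ι (sgn β) * q^ (T (γ ℤ.- + 2 ℤ.* β) ℕ.+ T β))
  combination≋ {M} {K} γ M≤K = begin
    combination γ * (P₁³ * P₁³)
      ≈⟨ solve 3 (λ s s′ p → (s :- s′) :* (p :* p) := p :* (s :* p :+ con -1ℤ :* (s′ :* p))) ≋-refl
           (S γ + S (ℤ.pred γ)) (S (γ ℤ.- + 2) + S (ℤ.pred (γ ℤ.- + 2))) P₁³ ⟩
    P₁³ * ((S γ + S (ℤ.pred γ)) * P₁³ + ι -1ℤ * ((S (γ ℤ.- + 2) + S (ℤ.pred (γ ℤ.- + 2))) * P₁³))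
      ≈⟨ *-congˡ (+-cong (S+S-pred γ M≤1+K) (*-congˡ (S+S-pred (γ ℤ.- + 2) M≤1+K))) ⟩
    P₁³ * (Σ± (suc K) f + ι -1ℤ * Σ± (suc K) (λ β → ι (sgn β) * (q^ T (γ ℤ.- + 2 ℤ.- + 2 ℤ.* β) * binomialA β)))
      ≈⟨ *-congˡ (+-congˡ (≋-trans (≋-sym (Σ±-*ˡ (suc K) _ _)) (Σ±-cong (suc K) shifted))) ⟩
    P₁³ * (Σ± (suc K) f + Σ± (suc K) (g ∘ ℤ.suc))
      -- The term entering at K + 1 contains `binomialA` at K, because g looks one place back; so
      -- the window must have size K + 1 when M ≤ K.
      ≈⟨ *-congˡ (+-congˡ (Σ±-suc {f = g} (boundary -[1+ suc K ] (ℕ.m≤n⇒m≤1+n M≤1+K)) (boundary (+ K) M≤K))) ⟩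
    P₁³ * (Σ± (suc K) f + Σ± (suc K) g)
      ≈⟨ *-congˡ (Σ±-+ (suc K) f g) ⟨
    P₁³ * Σ± (suc K) (λ β → f β + g β)
      ≈⟨ Σ±-*ˡ (suc K) P₁³ _ ⟨
    Σ± (suc K) (λ β → P₁³ * (f β + g β))
      ≈⟨ Σ±-cong (suc K) join ⟩
    Σ± (suc K) (λ β → ι (sgn β) * q^ (T (γ ℤ.- + 2 ℤ.* β) ℕ.+ T β)) ∎
    where
    open ≋-Reasoning
    M≤1+K = ℕ.m≤n⇒m≤1+n M≤K
    f g : ℤ → PowerSeries
    f β = ι (sgn β) * (q^ T (γ ℤ.- + 2 ℤ.* β) * binomialA β)
    g β = ι (sgn β) * (q^ T (γ ℤ.- + 2 ℤ.* β) * binomialA (ℤ.pred β))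
    index : ∀ γ β → γ ℤ.- + 2 ℤ.- + 2 ℤ.* β ≡ γ ℤ.- + 2 ℤ.* (1ℤ ℤ.+ β)
    index = solve-∀
    shifted : ∀ {M} β → ι -1ℤ * (ι (sgn β) * (q^ T (γ ℤ.- + 2 ℤ.- + 2 ℤ.* β) * binomialA β)) ≋[ M ] g (ℤ.suc β)
    shifted β = ≋-trans (≋-sym (*-assoc _ _ _)) (*-cong
      (≋-trans (≋-sym (ι-* -1ℤ (sgn β))) (≡⇒≋ (cong ι (sym (sgn-suc β)))))
      (*-cong (≡⇒≋ (cong (q^_ ∘ T) (index γ β))) (≡⇒≋ (cong binomialA (sym (ℤ.pred-suc β))))))
    boundary : ∀ {x y} β → M ≤ ∣ β ∣ → x * (y * binomialA β) ≋[ M ] 0#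
    boundary β M≤∣β∣ = ≋-trans (*-congˡ (≋-trans (*-congˡ (binomialA≋0 β M≤∣β∣)) (zeroʳ _))) (zeroʳ _)
    join : ∀ {M} β → P₁³ * (f β + g β) ≋[ M ] ι (sgn β) * q^ (T (γ ℤ.- + 2 ℤ.* β) ℕ.+ T β)
    join β = ≋-trans
      (solve 5 (λ p s t b b′ → p :* (s :* (t :* b) :+ s :* (t :* b′)) := s :* (t :* ((b :+ b′) :* p))) ≋-refl
        P₁³ (ι (sgn β)) (q^ T (γ ℤ.- + 2 ℤ.* β)) (binomialA β) (binomialA (ℤ.pred β)))
      (*-congˡ (≋-trans (*-congˡ (binomialA-adjacent β)) (q^-* (T (γ ℤ.- + 2 ℤ.* β)) (T β))))

  -- From the theta series to the reciprocal of R times F_5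

  residue-factor : ℕ → ℕ → PowerSeries
  residue-factor c i = 1ˢ -ˢ q^ (suc c ℕ.+ 5 ℕ.* i)

  R-factors-inverse : ∀ {M N} u v → M ≤ N →
    ∏^∞ (R-factor u v) (R-factor≡1 u v) * (Π< N (residue-factor u) * Π< N (residue-factor v)) ≋[ M ] 1#
  R-factors-inverse {M} {N} u v M≤N = begin
    ∏^∞ (R-factor u v) (R-factor≡1 u v) * (Π< N (residue-factor u) * Π< N (residue-factor v))
      ≈⟨ *-cong (∏^∞-truncate (R-factor u v) (R-factor≡1 u v) M≤N) (≋-sym (Π<-* N _ _)) ⟩
    Π< N (R-factor u v) * Π< N (λ i → residue-factor u i * residue-factor v i)
      ≈⟨ Π<-* N _ _ ⟨
    Π< N (λ i → R-factor u v i * (residue-factor u i * residue-factor v i))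
      ≈⟨ Π<-one N _ (λ i → begin
           R-factor u v i * (residue-factor u i * residue-factor v i)     ≈⟨ *-comm _ _ ⟩
           (residue-factor u i * residue-factor v i) * R-factor u v i     ≈⟨ *-congʳ *ˢ≋* ⟨
           (residue-factor u i *ˢ residue-factor v i) * R-factor u v i    ≈⟨ recip-inverse _ refl ⟩
           1#                                                             ∎) ⟩
    1# ∎
    where open ≋-Reasoning

  module Identity (u v : ℕ) (1+u+1+v≡5 : suc u ℕ.+ suc v ≡ 5) (R : PowerSeries)
    (R-inverse : ∀ {M N} → M ≤ N → R * (Π< N (residue-factor u) * Π< N (residue-factor v)) ≋[ M ] 1#) where
    open Theta (suc u) (suc v) (s≤s z≤n)

    P₅ : PowerSeries
    P₅ = qPochhammer (q^ 5) (q^ 5) (O-≤ (s≤s z≤n) (O-q^ 5))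

    product : ℕ → PowerSeries
    product N = Π< N (λ i → 1# + b * p ^ i) * Π< N (λ i → 1# + a * p ^ i)

    factor≋ : ∀ {M} c i → 1# + (- q^ suc c) * p ^ i ≋[ M ] residue-factor c i
    factor≋ c i = begin
      1# + (- q^ suc c) * p ^ i           ≈⟨ solve 2 (λ x y → con 1ℤ :+ (:- x) :* y := con 1ℤ :- x :* y) ≋-refl
          (q^ suc c) (p ^ i) ⟩
      1# - q^ suc c * p ^ i               ≈⟨ +-congˡ (-‿cong (*-congˡ (q^-^ d i))) ⟩
      1# - q^ suc c * q^ (i ℕ.* d)        ≈⟨ +-congˡ (-‿cong (q^-* (suc c) (i ℕ.* d))) ⟩
      1# - q^ (suc c ℕ.+ i ℕ.* d)         ≡⟨ cong (λ e → 1# - q^ (suc c ℕ.+ e))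
          (trans (cong (i ℕ.*_) 1+u+1+v≡5) (ℕ.*-comm i 5)) ⟩
      1# - q^ (suc c ℕ.+ 5 ℕ.* i)         ≈⟨ ≋-trans -ˢ≋- (+-congʳ 1ˢ≋1#) ⟨
      residue-factor c i                  ∎
      where open ≋-Reasoning

    R*product : ∀ {M N} → M ≤ N → R * product N ≋[ M ] 1#
    R*product {N = N} M≤N = ≋-trans
      (*-congˡ (≋-trans (*-comm _ _) (*-cong (Π<-cong N (factor≋ u)) (Π<-cong N (factor≋ v))))) (R-inverse M≤N)

    P₅≋poch : ∀ {M N} → M ≤ N → P₅ ≋[ M ] poch N
    P₅≋poch {M} {N} M≤N = subst (λ e → P₅ ≋[ M ] JacobiTriple.poch (q^ e) N) (sym 1+u+1+v≡5)
      (qPochhammer≋poch 5 (O-≤ (s≤s z≤n) (O-q^ 5)) M≤N)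

    module _ (γ n : ℤ) (E₀ : ℕ)
             (complete-square : ∀ m → T (γ ℤ.- + 2 ℤ.* (n ℤ.+ n ℤ.+ m)) ℕ.+ T (n ℤ.+ n ℤ.+ m) ≡ E₀ ℕ.+ exponent m) where

      combination≋q^ : ∀ {M} → combination γ * (P₁³ * P₁³) * R ≋[ M ] q^ E₀ * P₅
      combination≋q^ {M} = begin
        combination γ * (P₁³ * P₁³) * R
          ≈⟨ *-congʳ (combination≋ γ M≤K) ⟩
        Σ± (suc K) f * R
          ≈⟨ *-congʳ (Σ±-translate {f = f} f≋0 (n ℤ.+ n) (ℕ.≤-trans (ℕ.m≤m+n _ _) (ℕ.m≤n+m _ (suc u ℕ.+ M)))) ⟨
        Σ± (suc K) (λ m → f (n ℤ.+ n ℤ.+ m)) * R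
          ≈⟨ *-congʳ (Σ±-cong (suc K) f≋term) ⟩
        Σ± (suc K) (λ m → q^ E₀ * term m) * R
          ≈⟨ *-congʳ (Σ±-*ˡ (suc K) (q^ E₀) term) ⟩
        q^ E₀ * Σ± (suc K) term * R
          ≈⟨ *-congʳ (*-congˡ (theta {M} {K} {K ℕ.+ K} (ℕ.m≤m+n (suc u ℕ.+ M) _) ℕ.≤-refl)) ⟨
        q^ E₀ * (product K * poch (K ℕ.+ K)) * R
          ≈⟨ solve 4 (λ e x y r → e :* (x :* y) :* r := e :* y :* (r :* x)) ≋-refl (q^ E₀) (product K)
              (poch (K ℕ.+ K)) R ⟩
        q^ E₀ * poch (K ℕ.+ K) * (R * product K)
          ≈⟨ *-cong (*-congˡ (≋-sym (P₅≋poch (ℕ.≤-trans M≤K (ℕ.m≤m+n K K))))) (R*product M≤K) ⟩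
        q^ E₀ * P₅ * 1#
          ≈⟨ *-identityʳ _ ⟩
        q^ E₀ * P₅ ∎
        where
        open ≋-Reasoning
        -- The first two summands are what `theta` asks for; |2n| + M + 1 is what the translation
        -- asks for, since the terms vanish modulo q^M from |β| = M + 1 on.
        K = suc u ℕ.+ M ℕ.+ (∣ n ℤ.+ n ∣ ℕ.+ suc M ℕ.+ 0)
        M≤K : M ≤ K
        M≤K = ℕ.≤-trans (ℕ.m≤n+m M (suc u)) (ℕ.m≤m+n (suc u ℕ.+ M) _)
        f : ℤ → PowerSeries
        f β = ι (sgn β) * q^ (T (γ ℤ.- + 2 ℤ.* β) ℕ.+ T β)
        f≋0 : ∀ β → suc M ≤ ∣ β ∣ → f β ≋[ M ] 0#
        f≋0 β M<∣β∣ = ≋-trans (*-congˡ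
            (q^≋0 (ℕ.≤-trans (ℕ.≤-pred (ℕ.≤-trans M<∣β∣ (∣α∣≤1+T β))) (ℕ.m≤n+m (T β) (T (γ ℤ.- + 2 ℤ.* β)))))) (zeroʳ _)
        f≋term : ∀ m → f (n ℤ.+ n ℤ.+ m) ≋[ M ] q^ E₀ * term m
        f≋term m = begin
          f (n ℤ.+ n ℤ.+ m)
            ≡⟨ cong₂ (λ s e → ι s * q^ e) (sgn-2+ n m) (complete-square m) ⟩
          ι (sgn m) * q^ (E₀ ℕ.+ exponent m)
            ≈⟨ *-congˡ (q^-* E₀ (exponent m)) ⟨
          ι (sgn m) * (q^ E₀ * q^ exponent m)
            ≈⟨ solve 3 (λ s x y → s :* (x :* y) := x :* (s :* y)) ≋-refl (ι (sgn m)) (q^ E₀) (q^ exponent m) ⟩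
          q^ E₀ * term m ∎

      -- R F_5 is R P₁⁶ / P₅, and `combination≋q^` evaluates the combination times R P₁⁶ as q^E₀ P₅.
      -- So the combination times R F_5 is q^E₀, and multiplication by the reciprocal finishes.
      identity : (R*F₅0≡1 : (R *ˢ F₅) 0 ≡ 1ℤ) → combination γ ≗ q^ E₀ * recip (R *ˢ F₅) R*F₅0≡1
      identity R*F₅0≡1 = exact λ M → begin
        c₀
          ≈⟨ ≋-trans (*-congˡ (recip-inverse (R *ˢ F₅) R*F₅0≡1)) (*-identityʳ c₀) ⟨
        c₀ * ((R *ˢ F₅) * r)
          ≈⟨ *-congˡ (*-congʳ (≋-trans (*ˢ≋* {f = R} {F₅})
              (*-congˡ {x = R} (≋-trans (*ˢ≋* {f = P₁ ^ˢ 6} {recip P₅ refl}) (*-congʳ (^ˢ≋^ P₁ 6)))))) ⟩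
        c₀ * (R * (P₁ ^ 6 * recip P₅ refl) * r)
          ≈⟨ solve 5 (λ c R p s r → c :* (R :* (p :* (p :* (p :* (p :* (p :* (p :* con 1ℤ))))) :* s) :* r)
                     := c :* (p :* p :* p :* (p :* p :* p)) :* R :* (s :* r)) ≋-refl c₀ R P₁ (recip P₅ refl) r ⟩
        c₀ * (P₁³ * P₁³) * R * (recip P₅ refl * r)
          ≈⟨ *-congʳ combination≋q^ ⟩
        q^ E₀ * P₅ * (recip P₅ refl * r)
          ≈⟨ solve 4 (λ e p s r → e :* p :* (s :* r) := e :* r :* (p :* s)) ≋-refl (q^ E₀) P₅ (recip P₅ refl) r ⟩
        q^ E₀ * r * (P₅ * recip P₅ refl)
          ≈⟨ ≋-trans (*-congˡ (recip-inverse P₅ refl)) (*-identityʳ _) ⟩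
        q^ E₀ * r ∎
        where
        open ≋-Reasoning
        c₀ = combination γ
        r = recip (R *ˢ F₅) R*F₅0≡1

  -- Coefficients of Laurent series

  private
    -- The case distinction in `coeff` as a function of its own, so that its integer argument can be
    -- rewritten by equations.
    coeffAt : PowerSeries → ℤ → ℤ
    coeffAt f (+ i)    = f i
    coeffAt f -[1+ _ ] = 0ℤ

    coeff≡coeffAt : ∀ e f m → coeff (q^⟨ e ⟩ f) m ≡ coeffAt f (m ℤ.- e)
    coeff≡coeffAt e f m with m ℤ.- e
    ... | + i      = refl
    ... | -[1+ i ] = refl

    coeffAt-q^-* : ∀ {f g} E → f ≗ q^ E * g → ∀ m → coeffAt g m ≡ coeffAt f (m ℤ.+ + E)
    coeffAt-q^-* {f} {g} E f≗q^E*g (+ i) = sym (begin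
      f (i ℕ.+ E)          ≡⟨ f≗q^E*g (i ℕ.+ E) ⟩
      (q^ E * g) (i ℕ.+ E) ≡⟨ cong (q^ E * g) (ℕ.+-comm i E) ⟩
      (q^ E * g) (E ℕ.+ i) ≡⟨ coeff-q^-* E g i ⟩
      g i                  ∎)
      where open ≡-Reasoning
    coeffAt-q^-* {f} {g} E f≗q^E*g -[1+ i ] with ℕ.<-≤-connex i E
    -- Here the index moved by E is non-negative although the original one is negative; f is
    -- divisible by q^E, so its coefficient below E is 0 as required.
    ... | inj₁ i<E = sym (trans (cong (coeffAt f) (ℤ.⊖-≥ i<E))
      (trans (f≗q^E*g (E ∸ suc i)) (coeff-q^-*-< E g (E ∸ suc i) (ℕ.∸-monoʳ-< {o = 0} (s≤s z≤n) i<E))))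
    ... | inj₂ E≤i = sym (cong (coeffAt f) (trans (ℤ.⊖-< (s≤s E≤i)) (cong (ℤ.-_ ∘ +_) (ℕ.+-∸-assoc 1 E≤i))))

  ≗⇒≈ : ∀ {f g} e E → e ≡ + E → f ≗ q^ E * g → (q^⟨ 0ℤ ⟩ g) ≈ (q^⟨ ℤ.- e ⟩ f)
  ≗⇒≈ {f} {g} e E refl f≗q^E*g m = begin
    coeff (q^⟨ 0ℤ ⟩ g) m           ≡⟨ coeff≡coeffAt 0ℤ g m ⟩
    coeffAt g (m ℤ.+ 0ℤ)           ≡⟨ cong (coeffAt g) (ℤ.+-identityʳ m) ⟩
    coeffAt g m                    ≡⟨ coeffAt-q^-* E f≗q^E*g m ⟩
    coeffAt f (m ℤ.+ + E)          ≡⟨ cong (λ i → coeffAt f (m ℤ.+ i)) (ℤ.neg-involutive (+ E)) ⟨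
    coeffAt f (m ℤ.- (ℤ.- + E))    ≡⟨ coeff≡coeffAt (ℤ.- + E) f m ⟨
    coeff (q^⟨ ℤ.- + E ⟩ f) m      ∎
    where open ≡-Reasoning

  combination≗ : ∀ γ {γ₁ γ₂ γ₃} → γ₁ ≡ ℤ.pred γ → γ₂ ≡ γ ℤ.- + 2 → γ₃ ≡ ℤ.pred (γ ℤ.- + 2) →
    S γ +ˢ S γ₁ -ˢ S γ₂ -ˢ S γ₃ ≗ combination γ
  combination≗ γ refl refl refl = exact λ M → begin
    S γ +ˢ S (ℤ.pred γ) -ˢ S (γ ℤ.- + 2) -ˢ S (ℤ.pred (γ ℤ.- + 2))
      ≈⟨ ≋-trans (-ˢ≋- {f = S γ +ˢ S (ℤ.pred γ) -ˢ S (γ ℤ.- + 2)} {S (ℤ.pred (γ ℤ.- + 2))})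
           (+-congʳ (≋-trans (-ˢ≋- {f = S γ +ˢ S (ℤ.pred γ)} {S (γ ℤ.- + 2)})
               (+-congʳ (+ˢ≋+ {f = S γ} {S (ℤ.pred γ)})))) ⟩
    S γ + S (ℤ.pred γ) - S (γ ℤ.- + 2) - S (ℤ.pred (γ ℤ.- + 2))
      ≈⟨ solve 4 (λ a b c d → a :+ b :- c :- d := (a :+ b) :- (c :+ d)) ≋-refl (S γ) (S (ℤ.pred γ))
          (S (γ ℤ.- + 2)) (S (ℤ.pred (γ ℤ.- + 2))) ⟩
    combination γ ∎
    where open ≋-Reasoning

  -- Completing the square

  private
    module Θ₁ = Theta 1 4 (s≤s z≤n)
    module Θ₂ = Theta 2 3 (s≤s z≤n)
    module Θ₃ = Theta 3 2 (s≤s z≤n)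

  2exponent : ∀ c c′ h α → + 2 ℤ.* + Theta.exponent c c′ h α ≡ + (c ℕ.+ c′) ℤ.* (α ℤ.* α ℤ.- α) ℤ.+ + 2 ℤ.* (+ c ℤ.* α)
  2exponent c c′ h α = begin
    + 2 ℤ.* + Theta.exponent c c′ h α                     ≡⟨ cong (λ i → + 2 ℤ.* i) (Theta.exponent≡ c c′ h α) ⟩
    + 2 ℤ.* (+ (c ℕ.+ c′) ℤ.* + T α ℤ.+ + c ℤ.* α)        ≡⟨ lemma (+ (c ℕ.+ c′)) (+ T α) (+ c) α ⟩
    + (c ℕ.+ c′) ℤ.* (+ 2 ℤ.* + T α) ℤ.+ + 2 ℤ.* (+ c ℤ.* α)
        ≡⟨ cong (λ i → + (c ℕ.+ c′) ℤ.* i ℤ.+ + 2 ℤ.* (+ c ℤ.* α)) (2T α) ⟩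
    + (c ℕ.+ c′) ℤ.* (α ℤ.* α ℤ.- α) ℤ.+ + 2 ℤ.* (+ c ℤ.* α) ∎
    where
    open ≡-Reasoning
    lemma : ∀ d t c a → + 2 ℤ.* (d ℤ.* t ℤ.+ c ℤ.* a) ≡ d ℤ.* (+ 2 ℤ.* t) ℤ.+ + 2 ℤ.* (c ℤ.* a)
    lemma = solve-∀

  -- Doubling removes the halves in T and turns the claim into a polynomial identity that the ring
  -- solver decides.
  T+T≡+ : ∀ α β E F → (α ℤ.* α ℤ.- α) ℤ.+ (β ℤ.* β ℤ.- β) ≡ + 2 ℤ.* + E ℤ.+ + 2 ℤ.* + F → T α ℕ.+ T β ≡ E ℕ.+ F
  T+T≡+ α β E F eq = ℤ.+-injective (ℤ.*-cancelˡ-≡ (+ 2) _ _ (begin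
    + 2 ℤ.* (+ T α ℤ.+ + T β)                             ≡⟨ ℤ.*-distribˡ-+ (+ 2) (+ T α) (+ T β) ⟩
    + 2 ℤ.* + T α ℤ.+ + 2 ℤ.* + T β                       ≡⟨ cong₂ ℤ._+_ (2T α) (2T β) ⟩
    (α ℤ.* α ℤ.- α) ℤ.+ (β ℤ.* β ℤ.- β)                   ≡⟨ eq ⟩
    + 2 ℤ.* + E ℤ.+ + 2 ℤ.* + F                           ≡⟨ ℤ.*-distribˡ-+ (+ 2) (+ E) (+ F) ⟨
    + 2 ℤ.* (+ E ℤ.+ + F)                                 ∎))
    where open ≡-Reasoning

  -- The pair (α, β) becomes (n + 1 - 2m, 2n + m). In the sum of the two squares the cross terms
  -- -4nm and 4nm cancel, so the exponent separates into (5n² - n)/2 = 5 T(n) + 2n and 5 T(m) + m.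
  complete-square₁₄ : ∀ n m → T (+ 5 ℤ.* n ℤ.+ + 1 ℤ.- + 2 ℤ.* (n ℤ.+ n ℤ.+ m)) ℕ.+ T (n ℤ.+ n ℤ.+ m)
      ≡ Θ₂.exponent n ℕ.+ Θ₁.exponent m
  complete-square₁₄ n m = T+T≡+ (+ 5 ℤ.* n ℤ.+ + 1 ℤ.- + 2 ℤ.* (n ℤ.+ n ℤ.+ m)) (n ℤ.+ n ℤ.+ m) (Θ₂.exponent n)
      (Θ₁.exponent m)
    (trans (lemma n m) (sym (cong₂ ℤ._+_ (2exponent 2 3 (s≤s z≤n) n) (2exponent 1 4 (s≤s z≤n) m))))
    where
    lemma : ∀ n m → ((+ 5 ℤ.* n ℤ.+ + 1 ℤ.- + 2 ℤ.* (n ℤ.+ n ℤ.+ m)) ℤ.*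
        (+ 5 ℤ.* n ℤ.+ + 1 ℤ.- + 2 ℤ.* (n ℤ.+ n ℤ.+ m)) ℤ.- (+ 5 ℤ.* n ℤ.+ + 1 ℤ.- + 2 ℤ.* (n ℤ.+ n ℤ.+ m)))
      ℤ.+ ((n ℤ.+ n ℤ.+ m) ℤ.* (n ℤ.+ n ℤ.+ m) ℤ.- (n ℤ.+ n ℤ.+ m)) ≡
      (+ 5 ℤ.* (n ℤ.* n ℤ.- n) ℤ.+ + 2 ℤ.* (+ 2 ℤ.* n)) ℤ.+ (+ 5 ℤ.* (m ℤ.* m ℤ.- m) ℤ.+ + 2 ℤ.* (+ 1 ℤ.* m))
    lemma = solve-∀

  -- Now the pair is (n - 2m, 2n + m), and the parts are (5n² - 3n)/2 = 5 T(n) + n and 5 T(m) + 3m.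
  complete-square₂₃ : ∀ n m → T (+ 5 ℤ.* n ℤ.- + 2 ℤ.* (n ℤ.+ n ℤ.+ m)) ℕ.+ T (n ℤ.+ n ℤ.+ m)
      ≡ Θ₁.exponent n ℕ.+ Θ₃.exponent m
  complete-square₂₃ n m = T+T≡+ (+ 5 ℤ.* n ℤ.- + 2 ℤ.* (n ℤ.+ n ℤ.+ m)) (n ℤ.+ n ℤ.+ m) (Θ₁.exponent n) (Θ₃.exponent m)
    (trans (lemma n m) (sym (cong₂ ℤ._+_ (2exponent 1 4 (s≤s z≤n) n) (2exponent 3 2 (s≤s z≤n) m))))
    where
    lemma : ∀ n m → ((+ 5 ℤ.* n ℤ.- + 2 ℤ.* (n ℤ.+ n ℤ.+ m)) ℤ.* (+ 5 ℤ.* n ℤ.- + 2 ℤ.* (n ℤ.+ n ℤ.+ m))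
        ℤ.- (+ 5 ℤ.* n ℤ.- + 2 ℤ.* (n ℤ.+ n ℤ.+ m)))
      ℤ.+ ((n ℤ.+ n ℤ.+ m) ℤ.* (n ℤ.+ n ℤ.+ m) ℤ.- (n ℤ.+ n ℤ.+ m)) ≡
      (+ 5 ℤ.* (n ℤ.* n ℤ.- n) ℤ.+ + 2 ℤ.* (+ 1 ℤ.* n)) ℤ.+ (+ 5 ℤ.* (m ℤ.* m ℤ.- m) ℤ.+ + 2 ℤ.* (+ 3 ℤ.* m))
    lemma = solve-∀

  -- The theta exponent at n serves as the witness that 5n² - n is even and non-negative, so the
  -- integer division in the theorem is exact.
  exponent₁₄ : ∀ n → (+ 5 ℤ.* n ℤ.^ 2 ℤ.- n) ℤ./ + 2 ≡ + Θ₂.exponent n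
  exponent₁₄ n = halve (Θ₂.exponent n) (trans (lemma n) (sym (2exponent 2 3 (s≤s z≤n) n)))
    where
    lemma : ∀ n → + 5 ℤ.* (n ℤ.* (n ℤ.* 1ℤ)) ℤ.- n ≡ + 5 ℤ.* (n ℤ.* n ℤ.- n) ℤ.+ + 2 ℤ.* (+ 2 ℤ.* n)
    lemma = solve-∀

  exponent₂₃ : ∀ n → (+ 5 ℤ.* n ℤ.^ 2 ℤ.- + 3 ℤ.* n) ℤ./ + 2 ≡ + Θ₁.exponent n
  exponent₂₃ n = halve (Θ₁.exponent n) (trans (lemma n) (sym (2exponent 1 4 (s≤s z≤n) n)))
    where
    lemma : ∀ n → + 5 ℤ.* (n ℤ.* (n ℤ.* 1ℤ)) ℤ.- + 3 ℤ.* n ≡ + 5 ℤ.* (n ℤ.* n ℤ.- n) ℤ.+ + 2 ℤ.* (+ 1 ℤ.* n)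
    lemma = solve-∀

  identity₁₄ : ∀ n → (q^⟨ 0ℤ ⟩ recip (R₁₄ *ˢ F₅) refl) ≈ (q^⟨ ℤ.- ((+ 5 ℤ.* n ℤ.^ 2 ℤ.- n) ℤ./ + 2) ⟩
    (S (+ 5 ℤ.* n ℤ.+ + 1) +ˢ S (+ 5 ℤ.* n) -ˢ S (+ 5 ℤ.* n ℤ.- + 1) -ˢ S (+ 5 ℤ.* n ℤ.- + 2)))
  identity₁₄ n = ≗⇒≈ _ (Θ₂.exponent n) (exponent₁₄ n) λ k →
    trans (combination≗ γ (lemma₁ (+ 5 ℤ.* n)) (lemma₂ (+ 5 ℤ.* n)) (lemma₃ (+ 5 ℤ.* n)) k)
          (Identity.identity 0 3 refl R₁₄ (R-factors-inverse 0 3) γ n (Θ₂.exponent n) (complete-square₁₄ n) refl k)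
    where
    γ = + 5 ℤ.* n ℤ.+ + 1
    lemma₁ : ∀ i → i ≡ -1ℤ ℤ.+ (i ℤ.+ + 1)
    lemma₁ = solve-∀
    lemma₂ : ∀ i → i ℤ.- + 1 ≡ i ℤ.+ + 1 ℤ.- + 2
    lemma₂ = solve-∀
    lemma₃ : ∀ i → i ℤ.- + 2 ≡ -1ℤ ℤ.+ (i ℤ.+ + 1 ℤ.- + 2)
    lemma₃ = solve-∀

  identity₂₃ : ∀ n → (q^⟨ 0ℤ ⟩ recip (R₂₃ *ˢ F₅) refl) ≈ (q^⟨ ℤ.- ((+ 5 ℤ.* n ℤ.^ 2 ℤ.- + 3 ℤ.* n) ℤ./ + 2) ⟩
    (S (+ 5 ℤ.* n) +ˢ S (+ 5 ℤ.* n ℤ.- + 1) -ˢ S (+ 5 ℤ.* n ℤ.- + 2) -ˢ S (+ 5 ℤ.* n ℤ.- + 3)))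
  identity₂₃ n = ≗⇒≈ _ (Θ₁.exponent n) (exponent₂₃ n) λ k →
    trans (combination≗ γ (ℤ.+-comm γ -1ℤ) refl (lemma γ) k)
          -- The linear coefficient 3 in the theta exponent makes the residues appear as 3 and 2, in
          -- the order opposite to `R₂₃`, hence the commutation.
          (Identity.identity 2 1 refl R₂₃ (λ M≤N → ≋-trans (*-congˡ (*-comm _ _)) (R-factors-inverse 1 2 M≤N))
              γ n (Θ₁.exponent n) (complete-square₂₃ n) refl k)
    where
    γ = + 5 ℤ.* n
    lemma : ∀ i → i ℤ.- + 3 ≡ -1ℤ ℤ.+ (i ℤ.- + 2)
    lemma = solve-∀

open import Data.Integer.Base using (ℤ; +_; 0ℤ; _+_; _-_; _*_; _^_; _/_; -_)

theorem1p3 : (n : ℤ) →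
    (q^⟨ 0ℤ ⟩ recip (R₁₄ *ˢ F₅) refl
    ≈ q^⟨ - ((+ 5 * n ^ 2 - n) / + 2) ⟩
    (S (+ 5 * n + + 1) +ˢ S (+ 5 * n) -ˢ S (+ 5 * n - + 1) -ˢ S (+ 5 * n - + 2)))
    × (q^⟨ 0ℤ ⟩ recip (R₂₃ *ˢ F₅) refl
    ≈ q^⟨ - ((+ 5 * n ^ 2 - + 3 * n) / + 2) ⟩
    (S (+ 5 * n) +ˢ S (+ 5 * n - + 1) -ˢ S (+ 5 * n - + 2) -ˢ S (+ 5 * n - + 3)))
theorem1p3 n = RogersRamanujan.identity₁₄ n , RogersRamanujan.identity₂₃ n
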